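{- The class of strongly base reorderable matroids is complete, i.e. it is closed under taking minors, duals, direct sums, truncations, and induction by directed graphs.
   Context: All matroids are finite. A matroid is strongly base reorderable (SBRO) if for any pair $A,B$ of bases there exist bases $A',B'$ and a bijection $\varphi\colon A'\setminus B'\to B'\setminus A'$ such that $A'\cap B'=A\cap B$, $A'\cup B'=A\cup B$, and $(A'\setminus X)\cup\varphi(X)$ is a basis for every $X\subseteq A'\setminus B'$. Following Ingleton, a class of matroids is complete if it is closed under minors, duals, direct sums, truncations (for a matroid $M$ and integer $k\ge 0$, the $k$-truncation has as independent sets the independent sets of $M$ of size at most $k$), and induction by directed graphs (given a directed graph $D=(V,A)$ and a matroid $N$ on a subset $S\subseteq V$, the induced matroid on $V$ has as independent sets those $X\subseteq V$ for which there exist $|X|$ pairwise vertex-disjoint directed paths starting at the elements of $X$ and ending in an independent set of $N$). -}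

module Defs where

open import Data.Nat using (ℕ; suc; _+_; _≤_; _<_)
open import Data.Fin using (Fin; zero; suc; inject₁; fromℕ)
open import Data.Fin.Properties using (any?) renaming (_≟_ to _≟F_)
open import Data.Fin.Subset
  using (Subset; ⊥; ⁅_⁆; _∈_; _∉_; _⊆_; ∁; _∩_; _∪_; _─_; ∣_∣)
open import Data.Fin.Subset.Properties using (_∈?_)
open import Data.Bool using (Bool; true)
open import Data.Vec using (tabulate; _++_)
open import Data.Product using (Σ; ∃; ∃-syntax; _×_; _,_)
open import Relation.Nullary using (¬_; Dec)
open import Relation.Nullary.Decidable using (⌊_⌋; _×-dec_)
open import Relation.Binary.PropositionalEquality using (_≡_; _≢_)
open import Function.Bundles using (_⇔_)

record Matroid (n : ℕ) : Set₁ where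
  field
    Ind      : Subset n → Set
    Ind?     : (X : Subset n) → Dec (Ind X)
    ind-∅    : Ind ⊥
    ind-⊆    : ∀ {X Y} → X ⊆ Y → Ind Y → Ind X
    ind-exch : ∀ {X Y} → Ind X → Ind Y → ∣ X ∣ < ∣ Y ∣ →
               ∃[ y ] (y ∈ Y × y ∉ X × Ind (X ∪ ⁅ y ⁆))

open Matroid public

IsBasis : ∀ {n} → Matroid n → Subset n → Set
IsBasis M B = Ind M B × (∀ x → x ∉ B → ¬ Ind M (B ∪ ⁅ x ⁆))

IsBasisOf : ∀ {n} → Matroid n → Subset n → Subset n → Set
IsBasisOf M C J =
  J ⊆ C × Ind M J × (∀ x → x ∈ C → x ∉ J → ¬ Ind M (J ∪ ⁅ x ⁆))

image : ∀ {m n} → (Fin m → Fin n) → Subset m → Subset n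
image f X = tabulate (λ y → ⌊ any? (λ x → (x ∈? X) ×-dec (f x ≟F y)) ⌋)

range : ∀ {m n} → (Fin m → Fin n) → Subset n
range f = tabulate (λ y → ⌊ any? (λ x → f x ≟F y) ⌋)

SBRO : ∀ {n} → Matroid n → Set
SBRO {n} M =
  ∀ A B → IsBasis M A → IsBasis M B →
  Σ (Subset n) λ A′ → Σ (Subset n) λ B′ → Σ (Fin n → Fin n) λ φ →
    IsBasis M A′ × IsBasis M B′ ×
    (A′ ∩ B′ ≡ A ∩ B) × (A′ ∪ B′ ≡ A ∪ B) ×
    (∀ x → x ∈ A′ ─ B′ → φ x ∈ B′ ─ A′) ×
    (∀ x y → x ∈ A′ ─ B′ → y ∈ A′ ─ B′ → φ x ≡ φ y → x ≡ y) ×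
    (∀ y → y ∈ B′ ─ A′ → ∃[ x ] (x ∈ A′ ─ B′ × φ x ≡ y)) ×
    (∀ X → X ⊆ A′ ─ B′ → IsBasis M ((A′ ─ X) ∪ image φ X))

-- The operations (each describes when a matroid IS the result of the
-- operation, by specifying its independent sets).

-- N (on Fin m) is the minor M / C \ D, with its ground set
-- E ∖ (C ∪ D) identified with Fin m via the injection e.
IsMinor : ∀ {n m} → Matroid n → (C D : Subset n) →
          Matroid m → (Fin m → Fin n) → Set
IsMinor M C D N e =
  (C ∩ D ≡ ⊥) ×
  (∀ i j → e i ≡ e j → i ≡ j) ×
  (range e ≡ ∁ (C ∪ D)) ×
  (∀ X → Ind N X ⇔ (∃[ J ] (IsBasisOf M C J × Ind M (image e X ∪ J))))

IsDual : ∀ {n} → Matroid n → Matroid n → Set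
IsDual M M* = ∀ X → Ind M* X ⇔ (∃[ B ] (IsBasis M B × X ⊆ ∁ B))

IsDirectSum : ∀ {m k} → Matroid m → Matroid k → Matroid (m + k) → Set
IsDirectSum M N S = ∀ X Y → Ind S (X ++ Y) ⇔ (Ind M X × Ind N Y)

IsTruncation : ∀ {n} → Matroid n → ℕ → Matroid n → Set
IsTruncation M k T = ∀ X → Ind T X ⇔ (Ind M X × ∣ X ∣ ≤ k)

Digraph : ℕ → Set
Digraph n = Fin n → Fin n → Bool

record Path {n} (G : Digraph n) : Set where
  field
    len   : ℕ
    vert  : Fin (suc len) → Fin n
    arcs  : ∀ (i : Fin len) → G (vert (inject₁ i)) (vert (suc i)) ≡ true
    simple : ∀ i j → vert i ≡ vert j → i ≡ j

  start : Fin n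
  start = vert zero

  end : Fin n
  end = vert (fromℕ len)

open Path public

-- X is linked into N (a matroid on S ⊆ V, S = range ι) in G: there are
-- |X| pairwise vertex-disjoint directed paths starting at the elements of
-- X and ending in an independent set of N.
Linked : ∀ {n s} → Digraph n → Matroid s → (Fin s → Fin n) → Subset n → Set
Linked {n} {s} G N ι X =
  Σ ℕ λ k → Σ (Fin k → Path G) λ P → Σ (Fin k → Fin s) λ T →
    (∀ x → x ∈ X ⇔ (∃[ i ] (start (P i) ≡ x))) ×
    (∀ i j → i ≢ j → ∀ a b → vert (P i) a ≢ vert (P j) b) ×
    (∀ i → ι (T i) ≡ end (P i)) ×
    Ind N (range T)

IsInduced : ∀ {n s} → Digraph n → Matroid s → (Fin s → Fin n) → Matroid n → Set
IsInduced G N ι M =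
  (∀ i j → ι i ≡ ι j → i ≡ j) × (∀ X → Ind M X ⇔ Linked G N ι X)

SBRO-ClosedUnderMinors : Set₁
SBRO-ClosedUnderMinors =
  ∀ {n m} (M : Matroid n) (C D : Subset n) (N : Matroid m) (e : Fin m → Fin n) →
  IsMinor M C D N e → SBRO M → SBRO N

SBRO-ClosedUnderDuals : Set₁
SBRO-ClosedUnderDuals =
  ∀ {n} (M M* : Matroid n) → IsDual M M* → SBRO M → SBRO M*

SBRO-ClosedUnderDirectSums : Set₁
SBRO-ClosedUnderDirectSums =
  ∀ {m k} (M : Matroid m) (N : Matroid k) (S : Matroid (m + k)) →
  IsDirectSum M N S → SBRO M → SBRO N → SBRO S

SBRO-ClosedUnderTruncations : Set₁
SBRO-ClosedUnderTruncations =
  ∀ {n} (M : Matroid n) (k : ℕ) (T : Matroid n) →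
  IsTruncation M k T → SBRO M → SBRO T

SBRO-ClosedUnderInduction : Set₁
SBRO-ClosedUnderInduction =
  ∀ {n s} (G : Digraph n) (N : Matroid s) (ι : Fin s → Fin n) (M : Matroid n) →
  IsInduced G N ι M → SBRO N → SBRO M

SBRO-Complete : Set₁
SBRO-Complete =
  SBRO-ClosedUnderMinors × SBRO-ClosedUnderDuals × SBRO-ClosedUnderDirectSums ×
  SBRO-ClosedUnderTruncations × SBRO-ClosedUnderInduction

{-# OPTIONS --safe #-}

-- Say that an involution π pairs A with B if it moves only elements of the
-- symmetric difference, and call Z a transversal if A ∩ B ⊆ Z ⊆ A ∪ B and Z
-- contains exactly one element of every pair {x , π x} with π x ≠ x.  A matroid
-- is SBRO iff any two bases have a pairing all of whose transversals are bases
-- (A′ and B′ being complementary transversals), and equivalently iff any two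
-- independent sets have a pairing all of whose transversals are independent.
-- The first form is self-dual; the second passes to minors and direct sums.  For
-- independent sets of equal size the pairing can be chosen such that all its
-- transversals have that size too, which settles truncations.
--
-- For induction by a digraph, a linking of A onto A₀ is a permutation of the
-- vertices sending A onto A₀ and every w ∉ A to itself or an in-neighbour.  The
-- permutations of two linkings A → A₀ and B → B₀, restricted to ∁ A and ∁ B, are
-- two matchings between copies of the vertex set; together with the pairs of a
-- pairing of A₀ with B₀ they form a graph of maximum degree two.  Its path
-- components with both ends in the symmetric difference of A and B define the
-- pairing of A with B, and a transversal prescribes how these paths are to be
-- traversed, which yields a linking onto a transversal of A₀ and B₀.
module Submission where

open import Defs

open import Data.Bool using (Bool; true; false; not)
open import Data.Bool.Properties using (not-involutive; ¬-not; not-¬) renaming (_≟_ to _≟B_)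
open import Data.Empty using (⊥-elim)
open import Data.Fin using (Fin; zero; suc; toℕ; inject₁; fromℕ; _↑ˡ_; _↑ʳ_; splitAt)
open import Data.Fin.Properties
  using (any?; fromℕ≢inject₁; toℕ-injective; toℕ<n; toℕ-inject₁; toℕ-fromℕ; pigeonhole;
         splitAt-↑ˡ; splitAt-↑ʳ; splitAt⁻¹-↑ˡ; splitAt⁻¹-↑ʳ; ↑ˡ-injective; ↑ʳ-injective)
  renaming (_≟_ to _≟F_)
import Data.Fin.Properties as Finₚ
open import Data.Fin.Relation.Unary.Top using (view; view-fromℕ; view-inject₁; ‵fromℕ; ‵inject₁)
open import Data.Fin.Subset using (Subset; ⁅_⁆; _∈_; _∉_; _⊆_; ∁; _∩_; _∪_; _─_; ∣_∣; inside; outside)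
open import Data.Fin.Subset.Properties
open import Data.List using (List; []; _∷_; allFin; cartesianProduct)
open import Data.List.Membership.Propositional using () renaming (_∈_ to _∈ᴸ_)
open import Data.List.Membership.Propositional.Properties using (∈-allFin; ∈-cartesianProduct⁺)
open import Data.List.Relation.Unary.Any using (here; there; tail)
open import Data.Nat using (ℕ; zero; suc; _+_; _≤_; _<_; s≤s; s≤s⁻¹; _<?_; _≤?_)
open import Data.Nat.Properties
  using (+-comm; +-suc; +-identityʳ; +-monoʳ-≤; +-mono-<-≤; <⇒≤; ≤-reflexive; ≤-trans; ≤-antisym; ≤-total;
         ≮⇒≥; ≰⇒>; <⇒≱; <⇒≢; <-irrefl; <-trans; <-≤-trans; <-asym; <-cmp; n<1+n; m<n⇒m<1+n; m≤n⇒m<n∨m≡n;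
         suc-injective; m≤m+n; m≤n+m; m≤n⇒∃[o]m+o≡n; module ≤-Reasoning)
open import Data.Product using (Σ; ∃-syntax; _×_; _,_; proj₁; proj₂)
open import Data.Product.Properties using (≡-dec)
open import Data.Sum using (_⊎_; inj₁; inj₂; swap; [_,_]′)
open import Data.Vec using ([]; _∷_; _++_; here; there; tabulate)
import Data.Vec as Vec
open import Data.Vec.Properties using (lookup⇒[]=; []=⇒lookup; lookup∘tabulate; lookup-++ˡ; lookup-++ʳ)
open import Function using (_∘_; id)
open import Function.Bundles using (module Equivalence; mk⇔)
open import Relation.Binary.Definitions using (DecidableEquality; tri<; tri≈; tri>)
open import Relation.Binary.PropositionalEquality
  using (_≡_; _≢_; refl; sym; trans; cong; cong₂; subst; module ≡-Reasoning)
open import Relation.Nullary using (¬_; Dec; yes; no; contradiction)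
open import Relation.Nullary.Decidable using (⌊_⌋; _×-dec_; _⊎-dec_; ¬?; decidable-stable; map′)

-- Subsets of a finite set: membership and cardinality.

private
  variable
    n : ℕ

module _ {P : Fin n → Set} (P? : ∀ x → Dec (P x)) where

  select : Subset n
  select = tabulate (λ x → ⌊ P? x ⌋)

  ∈-select⁺ : ∀ {x} → P x → x ∈ select
  ∈-select⁺ {x} px = lookup⇒[]= x select (trans (lookup∘tabulate _ x) isYes-true)
    where
    isYes-true : ⌊ P? x ⌋ ≡ true
    isYes-true with P? x
    ... | yes _  = refl
    ... | no ¬px = contradiction px ¬px

  ∈-select⁻ : ∀ {x} → x ∈ select → P x
  ∈-select⁻ {x} x∈ with P? x | trans (sym (lookup∘tabulate (λ y → ⌊ P? y ⌋) x)) ([]=⇒lookup x∈)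
  ... | yes px | _ = px
  ... | no _   | ()

module _ {m : ℕ} (f : Fin m → Fin n) where

  ∈-image⁺ : ∀ {X x y} → x ∈ X → f x ≡ y → y ∈ image f X
  ∈-image⁺ {X} x∈X fx≡y = ∈-select⁺ (λ y → any? (λ x → (x ∈? X) ×-dec (f x ≟F y))) (_ , x∈X , fx≡y)

  ∈-image⁻ : ∀ {X y} → y ∈ image f X → ∃[ x ] (x ∈ X × f x ≡ y)
  ∈-image⁻ {X} = ∈-select⁻ (λ y → any? (λ x → (x ∈? X) ×-dec (f x ≟F y)))

  ∈-range⁺ : ∀ {x y} → f x ≡ y → y ∈ range f
  ∈-range⁺ fx≡y = ∈-select⁺ (λ y → any? (λ x → f x ≟F y)) (_ , fx≡y)

  ∈-range⁻ : ∀ {y} → y ∈ range f → ∃[ x ] (f x ≡ y)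
  ∈-range⁻ = ∈-select⁻ (λ y → any? (λ x → f x ≟F y))

∈-─⁻ : ∀ (p q : Subset n) {x} → x ∈ p ─ q → x ∈ p × x ∉ q
∈-─⁻ p q x∈ = p─q⊆p p q x∈ , x∉q p q x∈
  where
  x∉q : ∀ {n} (p q : Subset n) {x} → x ∈ p ─ q → x ∉ q
  x∉q (_ ∷ p) (outside ∷ q) (there x∈) (there x∈q) = x∉q p q x∈ x∈q
  x∉q (_ ∷ p) (inside  ∷ q) (there x∈) (there x∈q) = x∉q p q x∈ x∈q

∣p∪q∣+∣p∩q∣≡∣p∣+∣q∣ : ∀ (p q : Subset n) → ∣ p ∪ q ∣ + ∣ p ∩ q ∣ ≡ ∣ p ∣ + ∣ q ∣
∣p∪q∣+∣p∩q∣≡∣p∣+∣q∣ []            []            = refl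
∣p∪q∣+∣p∩q∣≡∣p∣+∣q∣ (outside ∷ p) (outside ∷ q) = ∣p∪q∣+∣p∩q∣≡∣p∣+∣q∣ p q
∣p∪q∣+∣p∩q∣≡∣p∣+∣q∣ (outside ∷ p) (inside  ∷ q) =
  trans (cong suc (∣p∪q∣+∣p∩q∣≡∣p∣+∣q∣ p q)) (sym (+-suc _ _))
∣p∪q∣+∣p∩q∣≡∣p∣+∣q∣ (inside  ∷ p) (outside ∷ q) = cong suc (∣p∪q∣+∣p∩q∣≡∣p∣+∣q∣ p q)
∣p∪q∣+∣p∩q∣≡∣p∣+∣q∣ (inside  ∷ p) (inside  ∷ q) =
  cong suc (trans (+-suc _ _) (trans (cong suc (∣p∪q∣+∣p∩q∣≡∣p∣+∣q∣ p q)) (sym (+-suc _ _))))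

∣p∪q∣≤∣p∣+∣q∣ : ∀ (p q : Subset n) → ∣ p ∪ q ∣ ≤ ∣ p ∣ + ∣ q ∣
∣p∪q∣≤∣p∣+∣q∣ p q = subst (∣ p ∪ q ∣ ≤_) (∣p∪q∣+∣p∩q∣≡∣p∣+∣q∣ p q) (m≤m+n _ _)

disjoint⇒∣p∪q∣≡∣p∣+∣q∣ : ∀ (p q : Subset n) → (∀ {x} → x ∈ p → x ∉ q) → ∣ p ∪ q ∣ ≡ ∣ p ∣ + ∣ q ∣
disjoint⇒∣p∪q∣≡∣p∣+∣q∣ {n} p q disjoint = trans (sym (+-identityʳ _)) (trans (cong (∣ p ∪ q ∣ +_) (sym empty)) (∣p∪q∣+∣p∩q∣≡∣p∣+∣q∣ p q))
  where
  empty : ∣ p ∩ q ∣ ≡ 0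
  empty = trans (cong ∣_∣ (Empty-unique λ (_ , x∈) → let (x∈p , x∈q) = x∈p∩q⁻ p q x∈ in disjoint x∈p x∈q)) (∣⊥∣≡0 n)

∣p∪⁅x⁆∣≡1+∣p∣ : ∀ (p : Subset n) {x} → x ∉ p → ∣ p ∪ ⁅ x ⁆ ∣ ≡ suc ∣ p ∣
∣p∪⁅x⁆∣≡1+∣p∣ p {x} x∉p = begin
  ∣ p ∪ ⁅ x ⁆ ∣      ≡⟨ disjoint⇒∣p∪q∣≡∣p∣+∣q∣ p ⁅ x ⁆ (λ y∈p y∈x → x∉p (subst (_∈ p) (x∈⁅y⁆⇒x≡y x y∈x) y∈p)) ⟩
  ∣ p ∣ + ∣ ⁅ x ⁆ ∣  ≡⟨ cong (∣ p ∣ +_) (∣⁅x⁆∣≡1 x) ⟩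
  ∣ p ∣ + 1          ≡⟨ +-comm ∣ p ∣ 1 ⟩
  suc ∣ p ∣          ∎
  where open ≡-Reasoning

⊆∧∣∣≥⇒⊇ : ∀ {p q : Subset n} → p ⊆ q → ∣ q ∣ ≤ ∣ p ∣ → q ⊆ p
⊆∧∣∣≥⇒⊇ {p = p} p⊆q ∣q∣≤∣p∣ {x} x∈q = decidable-stable (x ∈? p) λ x∉p →
  <⇒≱ (p⊂q⇒∣p∣<∣q∣ (p⊆q , x , x∈q , x∉p)) ∣q∣≤∣p∣

∈-insert⁻ : ∀ (p : Subset n) {x y} → y ∈ p ∪ ⁅ x ⁆ → y ≢ x → y ∈ p
∈-insert⁻ p {x} y∈ y≢x with x∈p∪q⁻ p ⁅ x ⁆ y∈
... | inj₁ y∈p = y∈p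
... | inj₂ y∈x = contradiction (x∈⁅y⁆⇒x≡y x y∈x) y≢x

∈-insert⁺ : ∀ (p : Subset n) {x y} → y ∈ p → y ∈ p ∪ ⁅ x ⁆
∈-insert⁺ p {x} y∈p = p⊆p∪q ⁅ x ⁆ y∈p

∈-insert : ∀ (p : Subset n) x → x ∈ p ∪ ⁅ x ⁆
∈-insert p x = q⊆p∪q p ⁅ x ⁆ (x∈⁅x⁆ x)

insert-absorb : ∀ (p : Subset n) {x} → x ∈ p → p ∪ ⁅ x ⁆ ≡ p
insert-absorb p {x} x∈p = ⊆-antisym
  (λ {y} y∈ → [ id , (λ y∈x → subst (_∈ p) (sym (x∈⁅y⁆⇒x≡y x y∈x)) x∈p) ]′ (x∈p∪q⁻ p ⁅ x ⁆ y∈))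
  (∈-insert⁺ p)

-- Sizes of independent sets and bases.

module _ (M : Matroid n) where

  ind-∣∣≤basis : ∀ {B X} → IsBasis M B → Ind M X → ∣ X ∣ ≤ ∣ B ∣
  ind-∣∣≤basis (indB , maxB) indX = ≮⇒≥ λ ∣B∣<∣X∣ →
    let (y , _ , y∉B , indBy) = ind-exch M indB indX ∣B∣<∣X∣ in maxB y y∉B indBy

  ind-∣∣≥basis⇒basis : ∀ {B X} → IsBasis M B → Ind M X → ∣ B ∣ ≤ ∣ X ∣ → IsBasis M X
  ind-∣∣≥basis⇒basis {B} {X} basisB indX ∣B∣≤∣X∣ = indX , λ x x∉X indXx →
    <⇒≱ (subst (∣ B ∣ <_) (sym (∣p∪⁅x⁆∣≡1+∣p∣ X x∉X)) (s≤s ∣B∣≤∣X∣)) (ind-∣∣≤basis basisB indXx)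

  bases-∣∣≡ : ∀ {A B} → IsBasis M A → IsBasis M B → ∣ A ∣ ≡ ∣ B ∣
  bases-∣∣≡ basisA basisB = ≤-antisym (ind-∣∣≤basis basisB (proj₁ basisA)) (ind-∣∣≤basis basisA (proj₁ basisB))

-- Pairings, transversals and complementary transversals.

Differ : Subset n → Subset n → Fin n → Set
Differ A B x = (x ∈ A × x ∉ B) ⊎ (x ∈ B × x ∉ A)

module _ (A B : Subset n) where

  Differ⇒∈∪ : ∀ {x} → Differ A B x → x ∈ A ∪ B
  Differ⇒∈∪ (inj₁ (x∈A , _)) = p⊆p∪q B x∈A
  Differ⇒∈∪ (inj₂ (x∈B , _)) = q⊆p∪q A B x∈B

  Differ⇒∉∩ : ∀ {x} → Differ A B x → x ∉ A ∩ B
  Differ⇒∉∩ (inj₁ (_ , x∉B)) x∈∩ = x∉B (p∩q⊆q A B x∈∩)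
  Differ⇒∉∩ (inj₂ (_ , x∉A)) x∈∩ = x∉A (p∩q⊆p A B x∈∩)

  ∪∖∩⇒Differ : ∀ {x} → x ∈ A ∪ B → x ∉ A ∩ B → Differ A B x
  ∪∖∩⇒Differ x∈∪ x∉∩ with x∈p∪q⁻ A B x∈∪
  ... | inj₁ x∈A = inj₁ (x∈A , λ x∈B → x∉∩ (x∈p∩q⁺ (x∈A , x∈B)))
  ... | inj₂ x∈B = inj₂ (x∈B , λ x∈A → x∉∩ (x∈p∩q⁺ (x∈A , x∈B)))

record Pairing (A B : Subset n) (π : Fin n → Fin n) : Set where
  field
    involutive : ∀ x → π (π x) ≡ x
    moved      : ∀ {x} → π x ≢ x → Differ A B x

-- A fixed point of the pairing in the symmetric difference may be
-- included in a transversal or not.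
record Transversal (A B : Subset n) (π : Fin n → Fin n) (Z : Subset n) : Set where
  field
    ∩⊆      : ∀ {x} → x ∈ A → x ∈ B → x ∈ Z
    ⊆∪      : ∀ {x} → x ∈ Z → x ∈ A ⊎ x ∈ B
    atMost  : ∀ {x} → π x ≢ x → x ∈ Z → π x ∉ Z
    atLeast : ∀ {x} → π x ≢ x → x ∉ Z → π x ∈ Z

-- Fixed points of `π` leave the size of a transversal open, so `EqPairing` asks for it explicitly;
-- this forces `π` to move the whole symmetric difference. In `IndPairing` the sizes of `A` and `B`
-- may differ.
EqPairing IndPairing BasePairing : Matroid n → Set
EqPairing M = ∀ A B → Ind M A → Ind M B → ∣ A ∣ ≡ ∣ B ∣ →
  ∃[ π ] (Pairing A B π × (∀ Z → Transversal A B π Z → Ind M Z × ∣ Z ∣ ≡ ∣ A ∣))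
IndPairing M = ∀ A B → Ind M A → Ind M B →
  ∃[ π ] (Pairing A B π × (∀ Z → Transversal A B π Z → Ind M Z))
BasePairing M = ∀ A B → IsBasis M A → IsBasis M B →
  ∃[ π ] (Pairing A B π × (∀ Z → Transversal A B π Z → IsBasis M Z))

module _ {A B : Subset n} {π : Fin n → Fin n} (pairing : Pairing A B π) where

  open Pairing pairing

  fixes-both : ∀ {x} → x ∈ A → x ∈ B → π x ≡ x
  fixes-both {x} x∈A x∈B = decidable-stable (π x ≟F x) λ πx≢x →
    [ (λ (_ , x∉B) → x∉B x∈B) , (λ (_ , x∉A) → x∉A x∈A) ]′ (moved πx≢x)

  π-moved : ∀ {x} → π x ≢ x → π (π x) ≢ π x
  π-moved πx≢x eq = πx≢x (trans (sym eq) (involutive _))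

  pairing-sym : Pairing B A π
  pairing-sym = record { involutive = involutive ; moved = swap ∘ moved }

  transversal-sym : ∀ {Z} → Transversal A B π Z → Transversal B A π Z
  transversal-sym t = record
    { ∩⊆ = λ b a → ∩⊆ a b ; ⊆∪ = swap ∘ ⊆∪ ; atMost = atMost ; atLeast = atLeast }
    where open Transversal t

  module _ {Z : Subset n} (t : Transversal A B π Z) where

    open Transversal t

    private
      Z′ : Subset n
      Z′ = (A ∩ B) ∪ ((A ∪ B) ─ Z)

      ∈Z′⁺ : ∀ {x} → Differ A B x → x ∉ Z → x ∈ Z′
      ∈Z′⁺ d x∉Z = q⊆p∪q (A ∩ B) _ (x∈p∧x∉q⇒x∈p─q (Differ⇒∈∪ A B d) x∉Z)

      ∈Z′⁻ : ∀ {x} → Differ A B x → x ∈ Z′ → x ∉ Z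
      ∈Z′⁻ d x∈Z′ with x∈p∪q⁻ (A ∩ B) _ x∈Z′
      ... | inj₂ x∈─ = proj₂ (∈-─⁻ (A ∪ B) Z x∈─)
      ... | inj₁ x∈∩ = contradiction x∈∩ (Differ⇒∉∩ A B d)

    -- Inside the symmetric difference `Z′` is the complement of `Z`, and both contain `A ∩ B`. So
    -- they have the union and the intersection of `A` and `B`, and the sizes follow by modularity
    -- of cardinality.
    complement : ∃[ Z′ ] (Transversal A B π Z′ × ∣ Z ∣ + ∣ Z′ ∣ ≡ ∣ A ∣ + ∣ B ∣)
    complement = Z′ , t′ , sizes
      where
      t′ : Transversal A B π Z′
      t′ = record
        { ∩⊆ = λ x∈A x∈B → p⊆p∪q _ (x∈p∩q⁺ (x∈A , x∈B))
        ; ⊆∪ = λ x∈Z′ → [ (λ x∈∩ → inj₁ (p∩q⊆p A B x∈∩))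
                        , (λ x∈─ → x∈p∪q⁻ A B (p─q⊆p (A ∪ B) Z x∈─)) ]′ (x∈p∪q⁻ (A ∩ B) _ x∈Z′)
        ; atMost = λ m x∈Z′ πx∈Z′ →
            ∈Z′⁻ (moved (π-moved m)) πx∈Z′ (atLeast m (∈Z′⁻ (moved m) x∈Z′))
        ; atLeast = λ {x} m x∉Z′ → ∈Z′⁺ (moved (π-moved m)) (atMost m
            (decidable-stable (x ∈? Z) λ x∉Z → x∉Z′ (∈Z′⁺ (moved m) x∉Z)))
        }

      union : Z ∪ Z′ ≡ A ∪ B
      union = ⊆-antisym
        (λ x∈ → [ (λ x∈Z → x∈p∪q⁺ (⊆∪ x∈Z)) , (λ x∈Z′ → x∈p∪q⁺ (Transversal.⊆∪ t′ x∈Z′)) ]′ (x∈p∪q⁻ Z Z′ x∈))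
        from
        where
        from : A ∪ B ⊆ Z ∪ Z′
        from {x} x∈ with x ∈? Z
        ... | yes x∈Z = p⊆p∪q Z′ x∈Z
        ... | no  x∉Z = q⊆p∪q Z Z′ (q⊆p∪q (A ∩ B) _ (x∈p∧x∉q⇒x∈p─q x∈ x∉Z))

      intersection : Z ∩ Z′ ≡ A ∩ B
      intersection = ⊆-antisym to (λ x∈ → let (x∈A , x∈B) = x∈p∩q⁻ A B x∈ in
        x∈p∩q⁺ (∩⊆ x∈A x∈B , Transversal.∩⊆ t′ x∈A x∈B))
        where
        to : Z ∩ Z′ ⊆ A ∩ B
        to x∈ with x∈p∩q⁻ Z Z′ x∈
        ... | x∈Z , x∈Z′ with x∈p∪q⁻ (A ∩ B) _ x∈Z′
        ...   | inj₁ x∈∩ = x∈∩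
        ...   | inj₂ x∈─ = contradiction x∈Z (proj₂ (∈-─⁻ (A ∪ B) Z x∈─))

      sizes : ∣ Z ∣ + ∣ Z′ ∣ ≡ ∣ A ∣ + ∣ B ∣
      sizes = begin
        ∣ Z ∣ + ∣ Z′ ∣            ≡⟨ ∣p∪q∣+∣p∩q∣≡∣p∣+∣q∣ Z Z′ ⟨
        ∣ Z ∪ Z′ ∣ + ∣ Z ∩ Z′ ∣   ≡⟨ cong₂ (λ u v → ∣ u ∣ + ∣ v ∣) union intersection ⟩
        ∣ A ∪ B ∣ + ∣ A ∩ B ∣     ≡⟨ ∣p∪q∣+∣p∩q∣≡∣p∣+∣q∣ A B ⟩
        ∣ A ∣ + ∣ B ∣             ∎
        where open ≡-Reasoning

  -- A transversal and its complement have total size 2r, and neither exceeds r.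
  transversal-basis : (M : Matroid n) → IsBasis M A → IsBasis M B →
                      (∀ Z → Transversal A B π Z → Ind M Z) →
                      ∀ Z → Transversal A B π Z → IsBasis M Z
  transversal-basis M basisA basisB ind Z t =
    let (Z′ , t′ , sizes) = complement t in
    ind-∣∣≥basis⇒basis M basisA (ind Z t) (≮⇒≥ λ ∣Z∣<∣A∣ →
      <-irrefl sizes (+-mono-<-≤ ∣Z∣<∣A∣ (ind-∣∣≤basis M basisB (ind Z′ t′))))

IndPairing⇒BasePairing : (M : Matroid n) → IndPairing M → BasePairing M
IndPairing⇒BasePairing M pairs A B basisA basisB =
  let (π , pairing , ind) = pairs A B (proj₁ basisA) (proj₁ basisB) in
  π , pairing , transversal-basis pairing M basisA basisB ind

-- From paired bases to strong base reorderability.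

module _ (M : Matroid n) (pairs : BasePairing M) where

  -- The order of `Fin n` breaks the symmetry of each pair: `A′` takes the smaller element, `B′` the
  -- larger one, and `π` itself is the exchange bijection.
  BasePairing⇒SBRO : SBRO M
  BasePairing⇒SBRO A B basisA basisB
    with π , pairing , bases ← pairs A B basisA basisB =
    A′ , B′ , π , bases A′ transversalA′ , bases B′ transversalB′ , intersection , union ,
    to , (λ x y _ _ πx≡πy → trans (sym (involutive x)) (trans (cong π πx≡πy) (involutive y))) ,
    (λ y y∈ → π y , from y y∈ , involutive y) ,
    (λ X X⊆ → bases _ (exchanged X X⊆))
    where
    open Pairing pairing

    InA′ InB′ : Fin n → Set
    -- By the weak inequality a fixed point in the symmetric difference would go to `A′` only.
    -- `Differ⇒moved` shows later that there is none.
    InA′ x = x ∈ A ∪ B × toℕ x ≤ toℕ (π x)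
    InB′ x = x ∈ A ∪ B × (x ∈ A ∩ B ⊎ toℕ (π x) < toℕ x)

    InA′? : ∀ x → Dec (InA′ x)
    InA′? x = (x ∈? A ∪ B) ×-dec (toℕ x ≤? toℕ (π x))

    InB′? : ∀ x → Dec (InB′ x)
    InB′? x = (x ∈? A ∪ B) ×-dec ((x ∈? A ∩ B) ⊎-dec (toℕ (π x) <? toℕ x))

    A′ B′ : Subset n
    A′ = select InA′?
    B′ = select InB′?

    ∩-fixed : ∀ {x} → x ∈ A ∩ B → π x ≡ x
    ∩-fixed x∈ = let (x∈A , x∈B) = x∈p∩q⁻ A B x∈ in fixes-both pairing x∈A x∈B

    moved-<⊎> : ∀ {x} → π x ≢ x → toℕ x < toℕ (π x) ⊎ toℕ (π x) < toℕ x
    moved-<⊎> {x} m with <-cmp (toℕ x) (toℕ (π x))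
    ... | tri< lt _ _ = inj₁ lt
    ... | tri≈ _ eq _ = contradiction (sym (toℕ-injective eq)) m
    ... | tri> _ _ gt = inj₂ gt

    >⇒moved : ∀ {x} → toℕ (π x) < toℕ x → π x ≢ x
    >⇒moved gt eq = <-irrefl (cong toℕ eq) gt

    <⇒moved : ∀ {x} → toℕ x < toℕ (π x) → π x ≢ x
    <⇒moved lt eq = <-irrefl (cong toℕ (sym eq)) lt

    ππ< : ∀ {x} → toℕ x < toℕ (π x) → toℕ (π (π x)) < toℕ (π x)
    ππ< {x} = subst (λ y → toℕ y < toℕ (π x)) (sym (involutive x))

    ππ> : ∀ {x} → toℕ (π x) < toℕ x → toℕ (π x) < toℕ (π (π x))
    ππ> {x} = subst (λ y → toℕ (π x) < toℕ y) (sym (involutive x))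

    <⇒∈A′ : ∀ {x} → toℕ x < toℕ (π x) → x ∈ A′
    <⇒∈A′ lt = ∈-select⁺ InA′? (Differ⇒∈∪ A B (moved (<⇒moved lt)) , <⇒≤ lt)

    <⇒∉B′ : ∀ {x} → toℕ x < toℕ (π x) → x ∉ B′
    <⇒∉B′ lt x∈B′ with ∈-select⁻ InB′? x∈B′
    ... | _ , inj₁ x∈∩ = <⇒moved lt (∩-fixed x∈∩)
    ... | _ , inj₂ gt  = <-asym lt gt

    >⇒∈B′ : ∀ {x} → toℕ (π x) < toℕ x → x ∈ B′
    >⇒∈B′ gt = ∈-select⁺ InB′? (Differ⇒∈∪ A B (moved (>⇒moved gt)) , inj₂ gt)

    >⇒∉A′ : ∀ {x} → toℕ (π x) < toℕ x → x ∉ A′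
    >⇒∉A′ gt x∈A′ = <⇒≱ gt (proj₂ (∈-select⁻ InA′? x∈A′))

    ∩⊆A′ : ∀ {x} → x ∈ A → x ∈ B → x ∈ A′
    ∩⊆A′ x∈A x∈B = ∈-select⁺ InA′? (p⊆p∪q B x∈A , ≤-reflexive (cong toℕ (sym (fixes-both pairing x∈A x∈B))))

    ∩⊆B′ : ∀ {x} → x ∈ A → x ∈ B → x ∈ B′
    ∩⊆B′ x∈A x∈B = ∈-select⁺ InB′? (p⊆p∪q B x∈A , inj₁ (x∈p∩q⁺ (x∈A , x∈B)))

    A′⊆∪ : ∀ {x} → x ∈ A′ → x ∈ A ∪ B
    A′⊆∪ x∈ = proj₁ (∈-select⁻ InA′? x∈)

    B′⊆∪ : ∀ {x} → x ∈ B′ → x ∈ A ∪ B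
    B′⊆∪ x∈ = proj₁ (∈-select⁻ InB′? x∈)

    transversalA′ : Transversal A B π A′
    transversalA′ = record
      { ∩⊆      = ∩⊆A′
      ; ⊆∪      = x∈p∪q⁻ A B ∘ A′⊆∪
      ; atMost  = λ m x∈ → [ (λ lt → >⇒∉A′ (ππ< lt)) , (λ gt → contradiction x∈ (>⇒∉A′ gt)) ]′ (moved-<⊎> m)
      ; atLeast = λ m x∉ → [ (λ lt → contradiction (<⇒∈A′ lt) x∉) , (λ gt → <⇒∈A′ (ππ> gt)) ]′ (moved-<⊎> m)
      }

    transversalB′ : Transversal A B π B′
    transversalB′ = record
      { ∩⊆      = ∩⊆B′
      ; ⊆∪      = x∈p∪q⁻ A B ∘ B′⊆∪
      ; atMost  = λ m x∈ → [ (λ lt → contradiction x∈ (<⇒∉B′ lt)) , (λ gt → <⇒∉B′ (ππ> gt)) ]′ (moved-<⊎> m)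
      ; atLeast = λ m x∉ → [ (λ lt → >⇒∈B′ (ππ< lt)) , (λ gt → contradiction (>⇒∈B′ gt) x∉) ]′ (moved-<⊎> m)
      }

    -- Otherwise B′ and B′ ∪ ⁅ x ⁆ would both be transversals, hence bases.
    Differ⇒moved : ∀ {x} → Differ A B x → π x ≢ x
    Differ⇒moved {x} d πx≡x = proj₂ (bases B′ transversalB′) x x∉B′ (proj₁ (bases (B′ ∪ ⁅ x ⁆) t))
      where
      x∉B′ : x ∉ B′
      x∉B′ x∈B′ with ∈-select⁻ InB′? x∈B′
      ... | _ , inj₂ gt = >⇒moved gt πx≡x
      ... | _ , inj₁ x∈∩ = Differ⇒∉∩ A B d x∈∩

      πy≢x : ∀ {y} → π y ≢ y → π y ≢ x
      πy≢x m refl = m (trans (sym πx≡x) (involutive _))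

      y≢x : ∀ {y} → π y ≢ y → y ≢ x
      y≢x m refl = m πx≡x

      open Transversal transversalB′
      t : Transversal A B π (B′ ∪ ⁅ x ⁆)
      t = record
        { ∩⊆      = λ y∈A y∈B → ∈-insert⁺ B′ (∩⊆ y∈A y∈B)
        ; ⊆∪      = λ y∈ → [ ⊆∪ , (λ y∈x → subst (λ y → y ∈ A ⊎ y ∈ B) (sym (x∈⁅y⁆⇒x≡y x y∈x)) (x∈p∪q⁻ A B (Differ⇒∈∪ A B d))) ]′
                             (x∈p∪q⁻ B′ ⁅ x ⁆ y∈)
        ; atMost  = λ m y∈ πy∈ → atMost m (∈-insert⁻ B′ y∈ (y≢x m)) (∈-insert⁻ B′ πy∈ (πy≢x m))
        ; atLeast = λ m y∉ → ∈-insert⁺ B′ (atLeast m (y∉ ∘ ∈-insert⁺ B′))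
        }

    intersection : A′ ∩ B′ ≡ A ∩ B
    intersection = ⊆-antisym ⊆∩ λ x∈ → let (x∈A , x∈B) = x∈p∩q⁻ A B x∈ in x∈p∩q⁺ (∩⊆A′ x∈A x∈B , ∩⊆B′ x∈A x∈B)
      where
      ⊆∩ : A′ ∩ B′ ⊆ A ∩ B
      ⊆∩ x∈ with x∈p∩q⁻ A′ B′ x∈
      ... | x∈A′ , x∈B′ with ∈-select⁻ InB′? x∈B′
      ...   | _ , inj₁ x∈∩ = x∈∩
      ...   | _ , inj₂ gt  = contradiction x∈A′ (>⇒∉A′ gt)

    union : A′ ∪ B′ ≡ A ∪ B
    union = ⊆-antisym (λ x∈ → [ A′⊆∪ , B′⊆∪ ]′ (x∈p∪q⁻ A′ B′ x∈)) ∪⊆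
      where
      ∪⊆ : A ∪ B ⊆ A′ ∪ B′
      ∪⊆ {x} x∈ with toℕ x ≤? toℕ (π x)
      ... | yes le = p⊆p∪q B′ (∈-select⁺ InA′? (x∈ , le))
      ... | no ¬le = q⊆p∪q A′ B′ (>⇒∈B′ (≰⇒> ¬le))

    ∈A′─B′⁻ : ∀ {x} → x ∈ A′ ─ B′ → toℕ x < toℕ (π x)
    ∈A′─B′⁻ x∈ =
      let (x∈A′ , x∉B′) = ∈-─⁻ A′ B′ x∈
          d = ∪∖∩⇒Differ A B (A′⊆∪ x∈A′) (λ x∈∩ → x∉B′ (∈-select⁺ InB′? (A′⊆∪ x∈A′ , inj₁ x∈∩)))
      in [ id , (λ gt → contradiction x∈A′ (>⇒∉A′ gt)) ]′ (moved-<⊎> (Differ⇒moved d))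

    ∈B′─A′⁻ : ∀ {x} → x ∈ B′ ─ A′ → toℕ (π x) < toℕ x
    ∈B′─A′⁻ x∈ =
      let (x∈B′ , x∉A′) = ∈-─⁻ B′ A′ x∈
      in ≰⇒> (λ le → x∉A′ (∈-select⁺ InA′? (B′⊆∪ x∈B′ , le)))

    to : ∀ x → x ∈ A′ ─ B′ → π x ∈ B′ ─ A′
    to x x∈ = let lt = ππ< (∈A′─B′⁻ x∈) in x∈p∧x∉q⇒x∈p─q (>⇒∈B′ lt) (>⇒∉A′ lt)

    from : ∀ y → y ∈ B′ ─ A′ → π y ∈ A′ ─ B′
    from y y∈ = let gt = ππ> (∈B′─A′⁻ y∈) in x∈p∧x∉q⇒x∈p─q (<⇒∈A′ gt) (<⇒∉B′ gt)

    module _ (X : Subset n) (X⊆ : X ⊆ A′ ─ B′) where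

      private
        W : Subset n
        W = (A′ ─ X) ∪ image π X

      <⇒∈W : ∀ {x} → toℕ x < toℕ (π x) → x ∉ X → x ∈ W
      <⇒∈W lt x∉X = p⊆p∪q _ (x∈p∧x∉q⇒x∈p─q (<⇒∈A′ lt) x∉X)

      <⇒∉W : ∀ {x} → toℕ x < toℕ (π x) → x ∈ X → x ∉ W
      <⇒∉W lt x∈X x∈W with x∈p∪q⁻ (A′ ─ X) _ x∈W
      ... | inj₁ x∈ = proj₂ (∈-─⁻ A′ X x∈) x∈X
      ... | inj₂ x∈ with ∈-image⁻ π x∈
      ...   | u , u∈X , refl = <-asym lt (ππ< (∈A′─B′⁻ (X⊆ u∈X)))

      >⇒∈W : ∀ {x} → π x ∈ X → x ∈ W
      >⇒∈W πx∈X = q⊆p∪q (A′ ─ X) _ (∈-image⁺ π πx∈X (involutive _))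

      >⇒∉W : ∀ {x} → toℕ (π x) < toℕ x → π x ∉ X → x ∉ W
      >⇒∉W gt πx∉X x∈W with x∈p∪q⁻ (A′ ─ X) _ x∈W
      ... | inj₁ x∈ = >⇒∉A′ gt (p─q⊆p A′ X x∈)
      ... | inj₂ x∈ with ∈-image⁻ π x∈
      ...   | u , u∈X , refl = πx∉X (subst (_∈ X) (sym (involutive u)) u∈X)

      -- By the four lemmas above, of a pair with smaller element `x` the set `W` contains `π x` if
      -- `x ∈ X` and `x` otherwise, hence exactly one of the two.
      exchanged : Transversal A B π W
      exchanged = record { ∩⊆ = ∩⊆W ; ⊆∪ = W⊆∪ ; atMost = atMostW ; atLeast = atLeastW }
        where
        ∩⊆W : ∀ {x} → x ∈ A → x ∈ B → x ∈ W
        ∩⊆W x∈A x∈B = p⊆p∪q _ (x∈p∧x∉q⇒x∈p─q (∩⊆A′ x∈A x∈B)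
          (λ x∈X → proj₂ (∈-─⁻ A′ B′ (X⊆ x∈X)) (∩⊆B′ x∈A x∈B)))

        W⊆∪ : ∀ {x} → x ∈ W → x ∈ A ⊎ x ∈ B
        W⊆∪ x∈W with x∈p∪q⁻ (A′ ─ X) _ x∈W
        ... | inj₁ x∈ = x∈p∪q⁻ A B (A′⊆∪ (p─q⊆p A′ X x∈))
        ... | inj₂ x∈ with ∈-image⁻ π x∈
        ...   | u , u∈X , refl = x∈p∪q⁻ A B (B′⊆∪ (p─q⊆p B′ A′ (to u (X⊆ u∈X))))

        atMostW : ∀ {x} → π x ≢ x → x ∈ W → π x ∉ W
        atMostW {x} m x∈W πx∈W with moved-<⊎> m
        ... | inj₁ lt with x ∈? X
        ...   | yes x∈X = <⇒∉W lt x∈X x∈W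
        ...   | no  x∉X = >⇒∉W (ππ< lt) (x∉X ∘ subst (_∈ X) (involutive x)) πx∈W
        atMostW {x} m x∈W πx∈W | inj₂ gt with π x ∈? X
        ...   | yes πx∈X = <⇒∉W (ππ> gt) πx∈X πx∈W
        ...   | no  πx∉X = >⇒∉W gt πx∉X x∈W

        atLeastW : ∀ {x} → π x ≢ x → x ∉ W → π x ∈ W
        atLeastW {x} m x∉W with moved-<⊎> m
        ... | inj₁ lt with x ∈? X
        ...   | yes x∈X = >⇒∈W (subst (_∈ X) (sym (involutive x)) x∈X)
        ...   | no  x∉X = contradiction (<⇒∈W lt x∉X) x∉W
        atLeastW {x} m x∉W | inj₂ gt with π x ∈? X
        ...   | yes πx∈X = contradiction (>⇒∈W πx∈X) x∉W
        ...   | no  πx∉X = <⇒∈W (ππ> gt) πx∉X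

-- From strong base reorderability to paired bases.

module _ (U V : Subset n) (disjoint : ∀ {x} → x ∈ U → x ∉ V) (φ : Fin n → Fin n)
         (φ-to : ∀ x → x ∈ U → φ x ∈ V)
         (φ-inj : ∀ x y → x ∈ U → y ∈ U → φ x ≡ φ y → x ≡ y)
         (φ-onto : ∀ y → y ∈ V → ∃[ x ] (x ∈ U × φ x ≡ y)) where

  -- A pairing is symmetric whereas `φ` goes one way, so `φ` is glued with its inverse into an
  -- involution of the whole ground set.
  exchange : Fin n → Fin n
  exchange x with x ∈? U | x ∈? V
  ... | yes _ | _       = φ x
  ... | no _  | yes x∈V = proj₁ (φ-onto x x∈V)
  ... | no _  | no _    = x

  exchange-∈U : ∀ {x} → x ∈ U → exchange x ≡ φ x
  exchange-∈U {x} x∈U with x ∈? U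
  ... | yes _  = refl
  ... | no x∉U = contradiction x∈U x∉U

  exchange-∈V : ∀ {x} → x ∈ V → exchange x ∈ U × φ (exchange x) ≡ x
  exchange-∈V {x} x∈V with x ∈? U | x ∈? V
  ... | yes x∈U | _        = contradiction x∈V (disjoint x∈U)
  ... | no _    | yes x∈V′ = proj₂ (φ-onto x x∈V′)
  ... | no _    | no x∉V   = contradiction x∈V x∉V

  exchange-∉ : ∀ {x} → x ∉ U → x ∉ V → exchange x ≡ x
  exchange-∉ {x} x∉U x∉V with x ∈? U | x ∈? V
  ... | yes x∈U | _       = contradiction x∈U x∉U
  ... | no _    | yes x∈V = contradiction x∈V x∉V
  ... | no _    | no _    = refl

  exchange-involutive : ∀ x → exchange (exchange x) ≡ x
  exchange-involutive x = cases (x ∈? U) (x ∈? V)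
    where
    cases : Dec (x ∈ U) → Dec (x ∈ V) → exchange (exchange x) ≡ x
    cases (yes x∈U) _ rewrite exchange-∈U x∈U =
      let (∈U , eq) = exchange-∈V (φ-to x x∈U) in φ-inj _ _ ∈U x∈U eq
    cases (no _) (yes x∈V) =
      let (∈U , eq) = exchange-∈V x∈V in trans (exchange-∈U ∈U) eq
    cases (no x∉U) (no x∉V) rewrite exchange-∉ x∉U x∉V = exchange-∉ x∉U x∉V

-- By `transversal-basis` it is enough that transversals are independent. A transversal `Z` is
-- contained in the basis obtained from `A′` by exchanging the elements of `A′ ─ B′` that `Z` omits.
SBRO⇒BasePairing : (M : Matroid n) → SBRO M → BasePairing M
SBRO⇒BasePairing {n} M sbro A B basisA basisB
  with A′ , B′ , φ , basisA′ , basisB′ , ∩≡ , ∪≡ , φ-to , φ-inj , φ-onto , bases ← sbro A B basisA basisB =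
  π , pairing , transversal-basis pairing M basisA basisB ind
  where
  disjoint : ∀ {x} → x ∈ A′ ─ B′ → x ∉ B′ ─ A′
  disjoint x∈ x∈′ = proj₂ (∈-─⁻ B′ A′ x∈′) (p─q⊆p A′ B′ x∈)

  π : Fin n → Fin n
  π = exchange (A′ ─ B′) (B′ ─ A′) disjoint φ φ-to φ-inj φ-onto

  ∈A′⊎B′⇒Differ : ∀ {x} → x ∈ A′ ⊎ x ∈ B′ → ¬ (x ∈ A′ × x ∈ B′) → Differ A B x
  ∈A′⊎B′⇒Differ {x} x∈ x∉∩ = ∪∖∩⇒Differ A B (subst (x ∈_) ∪≡ (x∈p∪q⁺ x∈))
    (λ x∈∩ → x∉∩ (x∈p∩q⁻ A′ B′ (subst (x ∈_) (sym ∩≡) x∈∩)))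

  pairing : Pairing A B π
  pairing = record
    { involutive = exchange-involutive (A′ ─ B′) (B′ ─ A′) disjoint φ φ-to φ-inj φ-onto
    ; moved      = π-moved⇒Differ
    }
    where
    π-moved⇒Differ : ∀ {x} → π x ≢ x → Differ A B x
    π-moved⇒Differ {x} m with x ∈? A′ | x ∈? B′
    ... | yes x∈A′ | no x∉B′  = ∈A′⊎B′⇒Differ (inj₁ x∈A′) (x∉B′ ∘ proj₂)
    ... | no x∉A′  | yes x∈B′ = ∈A′⊎B′⇒Differ (inj₂ x∈B′) (x∉A′ ∘ proj₁)
    ... | yes x∈A′ | yes x∈B′ = contradiction
      (exchange-∉ (A′ ─ B′) (B′ ─ A′) disjoint φ φ-to φ-inj φ-onto
        (λ x∈ → proj₂ (∈-─⁻ A′ B′ x∈) x∈B′) (λ x∈ → proj₂ (∈-─⁻ B′ A′ x∈) x∈A′)) m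
    ... | no x∉A′  | no x∉B′  = contradiction
      (exchange-∉ (A′ ─ B′) (B′ ─ A′) disjoint φ φ-to φ-inj φ-onto
        (x∉A′ ∘ p─q⊆p A′ B′) (x∉B′ ∘ p─q⊆p B′ A′)) m

  ind : ∀ Z → Transversal A B π Z → Ind M Z
  ind Z t = ind-⊆ M Z⊆ (proj₁ (bases X (λ {x} x∈X → proj₁ (∈-select⁻ InX? x∈X))))
    where
    open Transversal t

    InX? : ∀ x → Dec (x ∈ A′ ─ B′ × x ∉ Z)
    InX? x = (x ∈? A′ ─ B′) ×-dec ¬? (x ∈? Z)

    X : Subset n
    X = select InX?

    Z⊆ : Z ⊆ (A′ ─ X) ∪ image φ X
    Z⊆ {x} x∈Z with x ∈? A′
    ... | yes x∈A′ = p⊆p∪q _ (x∈p∧x∉q⇒x∈p─q x∈A′ (λ x∈X → proj₂ (∈-select⁻ InX? x∈X) x∈Z))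
    ... | no  x∉A′ = q⊆p∪q (A′ ─ X) _ (∈-image⁺ φ (∈-select⁺ InX? (πx∈ , atMost m x∈Z)) φπx≡x)
      where
      x∈B′ : x ∈ B′
      x∈B′ = [ (λ x∈A′ → contradiction x∈A′ x∉A′) , id ]′
        (x∈p∪q⁻ A′ B′ (subst (x ∈_) (sym ∪≡) (x∈p∪q⁺ (⊆∪ x∈Z))))

      πx∈,φπx≡x : π x ∈ A′ ─ B′ × φ (π x) ≡ x
      πx∈,φπx≡x = exchange-∈V (A′ ─ B′) (B′ ─ A′) disjoint φ φ-to φ-inj φ-onto (x∈p∧x∉q⇒x∈p─q x∈B′ x∉A′)

      πx∈ : π x ∈ A′ ─ B′
      πx∈ = proj₁ πx∈,φπx≡x

      φπx≡x : φ (π x) ≡ x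
      φπx≡x = proj₂ πx∈,φπx≡x

      m : π x ≢ x
      m πx≡x = x∉A′ (subst (_∈ A′) πx≡x (p─q⊆p A′ B′ πx∈))

-- Pairing independent sets of equal size.

module _ {A B : Subset n} {π : Fin n → Fin n} {p q : Fin n}
         (p∉A : p ∉ A) (p∈B : p ∈ B) (q∈A : q ∈ A) (q∉B : q ∉ B)
         (pairing : Pairing (A ∪ ⁅ p ⁆) (B ∪ ⁅ q ⁆) π) where

  open Pairing pairing

  private
    A⁺ B⁺ : Subset n
    A⁺ = A ∪ ⁅ p ⁆
    B⁺ = B ∪ ⁅ q ⁆

    πp≡p : π p ≡ p
    πp≡p = fixes-both pairing (∈-insert A p) (∈-insert⁺ B p∈B)

    πq≡q : π q ≡ q
    πq≡q = fixes-both pairing (∈-insert⁺ A q∈A) (∈-insert B q)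

    p≢q : p ≢ q
    p≢q refl = p∉A q∈A

  -- With `p` added to `A` and `q` to `B`, both points are common to the two sets and fixed by `π`.
  -- Undoing the additions frees them to form a pair of their own.
  joinPair : Fin n → Fin n
  joinPair x with x ≟F p | x ≟F q
  ... | yes _ | _     = q
  ... | no _  | yes _ = p
  ... | no _  | no _  = π x

  private
    join-p : joinPair p ≡ q
    join-p with p ≟F p
    ... | yes _  = refl
    ... | no p≢p = contradiction refl p≢p

    join-q : joinPair q ≡ p
    join-q with q ≟F p | q ≟F q
    ... | yes refl | _      = refl
    ... | no _     | yes _  = refl
    ... | no _     | no q≢q = contradiction refl q≢q

    join-π : ∀ {x} → x ≢ p → x ≢ q → joinPair x ≡ π x
    join-π {x} x≢p x≢q with x ≟F p | x ≟F q
    ... | yes x≡p | _       = contradiction x≡p x≢p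
    ... | no _    | yes x≡q = contradiction x≡q x≢q
    ... | no _    | no _    = refl

    πx≢fixed : ∀ {x y} → π y ≡ y → x ≢ y → π x ≢ y
    πx≢fixed {x} πy≡y x≢y refl = x≢y (trans (sym (involutive x)) πy≡y)

  joinPair-pairing : Pairing A B joinPair
  joinPair-pairing = record { involutive = invol ; moved = moved′ }
    where
    invol : ∀ x → joinPair (joinPair x) ≡ x
    invol x = cases (x ≟F p) (x ≟F q)
      where
      cases : Dec (x ≡ p) → Dec (x ≡ q) → joinPair (joinPair x) ≡ x
      cases (yes refl) _ = trans (cong joinPair join-p) join-q
      cases (no _) (yes refl) = trans (cong joinPair join-q) join-p
      cases (no x≢p) (no x≢q) = trans (cong joinPair (join-π x≢p x≢q))
        (trans (join-π (πx≢fixed πp≡p x≢p) (πx≢fixed πq≡q x≢q)) (involutive x))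

    moved′ : ∀ {x} → joinPair x ≢ x → Differ A B x
    moved′ {x} m = cases (x ≟F p) (x ≟F q)
      where
      cases : Dec (x ≡ p) → Dec (x ≡ q) → Differ A B x
      cases (yes refl) _ = inj₂ (p∈B , p∉A)
      cases (no _) (yes refl) = inj₁ (q∈A , q∉B)
      cases (no x≢p) (no x≢q) with moved (m ∘ trans (join-π x≢p x≢q))
      ... | inj₁ (x∈A⁺ , x∉B⁺) = inj₁ (∈-insert⁻ A x∈A⁺ x≢p , x∉B⁺ ∘ ∈-insert⁺ B)
      ... | inj₂ (x∈B⁺ , x∉A⁺) = inj₂ (∈-insert⁻ B x∈B⁺ x≢q , x∉A⁺ ∘ ∈-insert⁺ A)

  module _ {Z : Subset n} (t : Transversal A B joinPair Z) where

    open Transversal t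

    private
      Z⁺ : Subset n
      Z⁺ = (Z ∪ ⁅ p ⁆) ∪ ⁅ q ⁆

      ∈Z⁺ : ∀ {x} → x ∈ Z → x ∈ Z⁺
      ∈Z⁺ = ∈-insert⁺ (Z ∪ ⁅ p ⁆) ∘ ∈-insert⁺ Z

      ∈Z⁺⁻ : ∀ {x} → x ∈ Z⁺ → x ≢ p → x ≢ q → x ∈ Z
      ∈Z⁺⁻ x∈ x≢p x≢q = ∈-insert⁻ Z (∈-insert⁻ (Z ∪ ⁅ p ⁆) x∈ x≢q) x≢p

      p∈Z⁺ : p ∈ Z⁺
      p∈Z⁺ = ∈-insert⁺ (Z ∪ ⁅ p ⁆) (∈-insert Z p)

      q∈Z⁺ : q ∈ Z⁺
      q∈Z⁺ = ∈-insert (Z ∪ ⁅ p ⁆) q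

      join-p-moved : joinPair p ≢ p
      join-p-moved eq = p≢q (trans (sym eq) join-p)

    -- `Z` contains exactly one of `p` and `q`, so `Z⁺` only gains the other one. This is also why
    -- its size goes up by exactly one.
    joinPair-transversal : Transversal A⁺ B⁺ π Z⁺
    joinPair-transversal = record { ∩⊆ = ∩⊆′ ; ⊆∪ = ⊆∪′ ; atMost = atMost′ ; atLeast = atLeast′ }
      where
      ∩⊆′ : ∀ {x} → x ∈ A⁺ → x ∈ B⁺ → x ∈ Z⁺
      ∩⊆′ {x} x∈A⁺ x∈B⁺ with x ≟F p | x ≟F q
      ... | yes refl | _        = p∈Z⁺
      ... | no _     | yes refl = q∈Z⁺
      ... | no x≢p   | no x≢q   = ∈Z⁺ (∩⊆ (∈-insert⁻ A x∈A⁺ x≢p) (∈-insert⁻ B x∈B⁺ x≢q))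

      ⊆∪′ : ∀ {x} → x ∈ Z⁺ → x ∈ A⁺ ⊎ x ∈ B⁺
      ⊆∪′ {x} x∈Z⁺ with x ≟F p | x ≟F q
      ... | yes refl | _        = inj₁ (∈-insert A p)
      ... | no _     | yes refl = inj₂ (∈-insert B q)
      ... | no x≢p   | no x≢q   = [ inj₁ ∘ ∈-insert⁺ A , inj₂ ∘ ∈-insert⁺ B ]′ (⊆∪ (∈Z⁺⁻ x∈Z⁺ x≢p x≢q))

      ≢p : ∀ {x} → π x ≢ x → x ≢ p
      ≢p m refl = m πp≡p

      ≢q : ∀ {x} → π x ≢ x → x ≢ q
      ≢q m refl = m πq≡q

      joined : ∀ {x} → π x ≢ x → joinPair x ≡ π x
      joined m = join-π (≢p m) (≢q m)

      atMost′ : ∀ {x} → π x ≢ x → x ∈ Z⁺ → π x ∉ Z⁺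
      atMost′ m x∈ πx∈ = atMost (m ∘ trans (sym (joined m))) (∈Z⁺⁻ x∈ (≢p m) (≢q m))
        (subst (_∈ Z) (sym (joined m)) (∈Z⁺⁻ πx∈ (≢p (π-moved pairing m)) (≢q (π-moved pairing m))))

      atLeast′ : ∀ {x} → π x ≢ x → x ∉ Z⁺ → π x ∈ Z⁺
      atLeast′ m x∉ = ∈Z⁺ (subst (_∈ Z) (joined m) (atLeast (m ∘ trans (sym (joined m))) (x∉ ∘ ∈Z⁺)))

    joinPair-∣∣ : ∣ Z⁺ ∣ ≡ suc ∣ Z ∣
    joinPair-∣∣ with p ∈? Z
    ... | yes p∈Z rewrite insert-absorb Z p∈Z =
      ∣p∪⁅x⁆∣≡1+∣p∣ Z (atMost join-p-moved p∈Z ∘ subst (_∈ Z) (sym join-p))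
    ... | no  p∉Z = trans (cong ∣_∣ (insert-absorb (Z ∪ ⁅ p ⁆) (∈-insert⁺ Z q∈Z))) (∣p∪⁅x⁆∣≡1+∣p∣ Z p∉Z)
      where
      q∈Z : q ∈ Z
      q∈Z = subst (_∈ Z) join-p (atLeast join-p-moved p∉Z)

module _ {A B : Subset n} {π : Fin n → Fin n} {p : Fin n}
         (pairing : Pairing (A ∪ ⁅ p ⁆) (B ∪ ⁅ p ⁆) π) where

  open Pairing pairing

  private
    ≢p : ∀ {x} → π x ≢ x → x ≢ p
    ≢p m refl = m (fixes-both pairing (∈-insert A p) (∈-insert B p))

  -- The point `p`, common to the enlarged sets, is fixed by `π`, so dropping it disturbs no pair.
  -- This serves both for a `p` outside `A` and `B` and for a `p` that lies in one of them.
  common-pairing : Pairing A B π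
  common-pairing = record { involutive = involutive ; moved = moved′ }
    where
    moved′ : ∀ {x} → π x ≢ x → Differ A B x
    moved′ m with moved m
    ... | inj₁ (x∈ , x∉) = inj₁ (∈-insert⁻ A x∈ (≢p m) , x∉ ∘ ∈-insert⁺ B)
    ... | inj₂ (x∈ , x∉) = inj₂ (∈-insert⁻ B x∈ (≢p m) , x∉ ∘ ∈-insert⁺ A)

  module _ {Z : Subset n} (t : Transversal A B π Z) where

    open Transversal t

    common-transversal : Transversal (A ∪ ⁅ p ⁆) (B ∪ ⁅ p ⁆) π (Z ∪ ⁅ p ⁆)
    common-transversal = record
      { ∩⊆ = ∩⊆′
      ; ⊆∪ = λ x∈ → [ [ inj₁ ∘ ∈-insert⁺ A , inj₂ ∘ ∈-insert⁺ B ]′ ∘ ⊆∪ , inj₁ ∘ q⊆p∪q A ⁅ p ⁆ ]′ (x∈p∪q⁻ Z ⁅ p ⁆ x∈)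
      ; atMost = λ m x∈ πx∈ → atMost m (∈-insert⁻ Z x∈ (≢p m)) (∈-insert⁻ Z πx∈ (≢p (π-moved pairing m)))
      ; atLeast = λ m x∉ → ∈-insert⁺ Z (atLeast m (x∉ ∘ ∈-insert⁺ Z))
      }
      where
      ∩⊆′ : ∀ {x} → x ∈ A ∪ ⁅ p ⁆ → x ∈ B ∪ ⁅ p ⁆ → x ∈ Z ∪ ⁅ p ⁆
      ∩⊆′ {x} x∈A⁺ x∈B⁺ with x ≟F p
      ... | yes refl = ∈-insert Z p
      ... | no x≢p   = ∈-insert⁺ Z (∩⊆ (∈-insert⁻ A x∈A⁺ x≢p) (∈-insert⁻ B x∈B⁺ x≢p))

    common-∣∣ : p ∉ A → p ∉ B → ∣ Z ∪ ⁅ p ⁆ ∣ ≡ suc ∣ Z ∣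
    common-∣∣ p∉A p∉B = ∣p∪⁅x⁆∣≡1+∣p∣ Z ([ p∉A , p∉B ]′ ∘ ⊆∪)

module _ (M : Matroid n) (pairs : BasePairing M) where

  private
    EqPair : Subset n → Subset n → Set
    EqPair A B = ∃[ π ] (Pairing A B π × (∀ Z → Transversal A B π Z → Ind M Z × ∣ Z ∣ ≡ ∣ A ∣))

    -- Induction from large sets to small ones, `larger` being the induction hypothesis. Either an
    -- element of `B` extends `A` (`spread`), or only elements outside `A ∪ B` do (`raise`), or `A`
    -- is a basis (`atBases`).
    module Step (A B : Subset n) (indA : Ind M A) (indB : Ind M B) (∣A∣≡∣B∣ : ∣ A ∣ ≡ ∣ B ∣)
                (larger : ∀ A⁺ B⁺ → Ind M A⁺ → Ind M B⁺ → ∣ A⁺ ∣ ≡ ∣ B⁺ ∣ → ∣ A⁺ ∣ ≡ suc ∣ A ∣ → EqPair A⁺ B⁺) where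

      ∣B∣<∣A⁺∣ : ∀ {p} → p ∉ A → ∣ B ∣ < ∣ A ∪ ⁅ p ⁆ ∣
      ∣B∣<∣A⁺∣ p∉A = ≤-reflexive (sym (trans (∣p∪⁅x⁆∣≡1+∣p∣ A p∉A) (cong suc ∣A∣≡∣B∣)))

      ∣A∣<∣B⁺∣ : ∀ {p} → p ∉ B → ∣ A ∣ < ∣ B ∪ ⁅ p ⁆ ∣
      ∣A∣<∣B⁺∣ p∉B = ≤-reflexive (sym (trans (∣p∪⁅x⁆∣≡1+∣p∣ B p∉B) (cong suc (sym ∣A∣≡∣B∣))))

      ∣A⁺∣≡∣B⁺∣ : ∀ {p q} → p ∉ A → q ∉ B → ∣ A ∪ ⁅ p ⁆ ∣ ≡ ∣ B ∪ ⁅ q ⁆ ∣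
      ∣A⁺∣≡∣B⁺∣ p∉A q∉B = trans (∣p∪⁅x⁆∣≡1+∣p∣ A p∉A) (trans (cong suc ∣A∣≡∣B∣) (sym (∣p∪⁅x⁆∣≡1+∣p∣ B q∉B)))

      -- Exchange between `B` and `A ∪ ⁅ p ⁆` yields a `q` extending `B`. As `p ∈ B`, this `q` is
      -- not `p` and comes from `A`, so `p` and `q` can be joined.
      spread : ∀ {p} → p ∈ B → p ∉ A → Ind M (A ∪ ⁅ p ⁆) → EqPair A B
      spread {p} p∈B p∉A indA⁺ with ind-exch M indB indA⁺ (∣B∣<∣A⁺∣ p∉A)
      ... | q , q∈A⁺ , q∉B , indB⁺ =
        let q∈A = ∈-insert⁻ A q∈A⁺ (λ { refl → q∉B p∈B })
            (π , pairing , ind) = larger (A ∪ ⁅ p ⁆) (B ∪ ⁅ q ⁆) indA⁺ indB⁺ (∣A⁺∣≡∣B⁺∣ p∉A q∉B) (∣p∪⁅x⁆∣≡1+∣p∣ A p∉A)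
        in joinPair p∉A p∈B q∈A q∉B pairing , joinPair-pairing p∉A p∈B q∈A q∉B pairing , λ Z t →
           let (indZ⁺ , ∣Z⁺∣) = ind _ (joinPair-transversal p∉A p∈B q∈A q∉B pairing t)
           in ind-⊆ M (∈-insert⁺ _ ∘ ∈-insert⁺ Z) indZ⁺ ,
              suc-injective (trans (sym (joinPair-∣∣ p∉A p∈B q∈A q∉B pairing t)) (trans ∣Z⁺∣ (∣p∪⁅x⁆∣≡1+∣p∣ A p∉A)))

      -- The same `p` extends `B`. Otherwise exchange gives a `y` from `A` outside `B`; a second
      -- exchange, of `A` with `B ∪ ⁅ y ⁆`, then extends `A` by an element of `B`, which `stuck`
      -- forbids.
      raise : (∀ p → p ∈ B → p ∉ A → ¬ Ind M (A ∪ ⁅ p ⁆)) →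
              ∀ {p} → p ∉ A → Ind M (A ∪ ⁅ p ⁆) → EqPair A B
      raise stuck {p} p∉A indA⁺ with ind-exch M indB indA⁺ (∣B∣<∣A⁺∣ p∉A)
      ... | y , y∈A⁺ , y∉B , indBy with y ≟F p
      ...   | no y≢p =
        let (z , z∈By , z∉A , indAz) = ind-exch M indA indBy (∣A∣<∣B⁺∣ y∉B)
        in contradiction indAz (stuck z (∈-insert⁻ B z∈By (λ z≡y → z∉A (subst (_∈ A) (sym z≡y) (∈-insert⁻ A y∈A⁺ y≢p)))) z∉A)
      ...   | yes refl =
        let p∉B = y∉B
            (π , pairing , ind) = larger (A ∪ ⁅ p ⁆) (B ∪ ⁅ p ⁆) indA⁺ indBy (∣A⁺∣≡∣B⁺∣ p∉A p∉B) (∣p∪⁅x⁆∣≡1+∣p∣ A p∉A)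
        in π , common-pairing pairing , λ Z t →
           let (indZ⁺ , ∣Z⁺∣) = ind _ (common-transversal pairing t)
           in ind-⊆ M (∈-insert⁺ Z) indZ⁺ ,
              suc-injective (trans (sym (common-∣∣ pairing t p∉A p∉B)) (trans ∣Z⁺∣ (∣p∪⁅x⁆∣≡1+∣p∣ A p∉A)))

      atBases : (∀ p → p ∉ A → ¬ Ind M (A ∪ ⁅ p ⁆)) → EqPair A B
      atBases maxA =
        let basisA = indA , maxA
            basisB = ind-∣∣≥basis⇒basis M basisA indB (≤-reflexive ∣A∣≡∣B∣)
            (π , pairing , bases) = pairs A B basisA basisB
        in π , pairing , λ Z t → proj₁ (bases Z t) , bases-∣∣≡ M (bases Z t) basisA

      step : EqPair A B
      step with any? (λ p → (p ∈? B) ×-dec ¬? (p ∈? A) ×-dec Ind? M (A ∪ ⁅ p ⁆))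
      ... | yes (p , p∈B , p∉A , indA⁺) = spread p∈B p∉A indA⁺
      ... | no ¬spread with any? (λ p → ¬? (p ∈? A) ×-dec Ind? M (A ∪ ⁅ p ⁆))
      ...   | yes (p , p∉A , indA⁺) = raise (λ p p∈B p∉A indA⁺ → ¬spread (p , p∈B , p∉A , indA⁺)) p∉A indA⁺
      ...   | no ¬raise = atBases (λ p p∉A indA⁺ → ¬raise (p , p∉A , indA⁺))

    -- `k` bounds how often the sets can still grow within `n` elements; at `zero` a larger set
    -- would have more than `n` elements.
    eqPair : ∀ k A B → Ind M A → Ind M B → ∣ A ∣ ≡ ∣ B ∣ → n ≤ ∣ A ∣ + k → EqPair A B
    eqPair zero A B indA indB ∣A∣≡∣B∣ n≤ = Step.step A B indA indB ∣A∣≡∣B∣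
      λ A⁺ B⁺ _ _ _ ∣A⁺∣ → ⊥-elim (<⇒≱ (subst (∣ A ∣ <_) (sym ∣A⁺∣) (n<1+n _))
        (≤-trans (∣p∣≤n A⁺) (subst (n ≤_) (+-identityʳ _) n≤)))
    eqPair (suc k) A B indA indB ∣A∣≡∣B∣ n≤ = Step.step A B indA indB ∣A∣≡∣B∣
      λ A⁺ B⁺ indA⁺ indB⁺ ∣A⁺∣≡∣B⁺∣ ∣A⁺∣ → eqPair k A⁺ B⁺ indA⁺ indB⁺ ∣A⁺∣≡∣B⁺∣
        (subst (n ≤_) (trans (+-suc _ _) (cong (_+ k) (sym ∣A⁺∣))) n≤)

  BasePairing⇒EqPairing : EqPairing M
  BasePairing⇒EqPairing A B indA indB ∣A∣≡∣B∣ = eqPair n A B indA indB ∣A∣≡∣B∣ (m≤n+m n ∣ A ∣)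

-- Pairing independent sets of any sizes.

module _ (M : Matroid n) (pairs : EqPairing M) where

  private
    IndPair : Subset n → Subset n → Set
    IndPair A B = ∃[ π ] (Pairing A B π × (∀ Z → Transversal A B π Z → Ind M Z))

    -- The element added to the smaller set becomes a fixed point of the pairing.
    indPair-≤ : ∀ k A B → Ind M A → Ind M B → ∣ A ∣ + k ≡ ∣ B ∣ → IndPair A B
    indPair-≤ zero A B indA indB eq =
      let (π , pairing , ind) = pairs A B indA indB (trans (sym (+-identityʳ _)) eq)
      in π , pairing , λ Z t → proj₁ (ind Z t)
    indPair-≤ (suc k) A B indA indB eq
      with b , b∈B , b∉A , indA⁺ ← ind-exch M indA indB
             (subst (suc ∣ A ∣ ≤_) (trans (sym (+-suc _ k)) eq) (m≤m+n (suc ∣ A ∣) k))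
      -- Since `b ∈ B`, the set `B ∪ ⁅ b ⁆` is `B` in disguise; written so, both sets have the shape
      -- that `common-pairing` strips.
      with π , pairing , ind ← indPair-≤ k (A ∪ ⁅ b ⁆) (B ∪ ⁅ b ⁆) indA⁺ (subst (Ind M) (sym (insert-absorb B b∈B)) indB)
             (trans (cong (_+ k) (∣p∪⁅x⁆∣≡1+∣p∣ A b∉A))
               (trans (sym (+-suc _ k)) (trans eq (cong ∣_∣ (sym (insert-absorb B b∈B))))))
      = π , common-pairing pairing , λ Z t → ind-⊆ M (∈-insert⁺ Z) (ind _ (common-transversal pairing t))

  EqPairing⇒IndPairing : IndPairing M
  EqPairing⇒IndPairing A B indA indB with ≤-total ∣ A ∣ ∣ B ∣
  ... | inj₁ ∣A∣≤∣B∣ = let (k , eq) = m≤n⇒∃[o]m+o≡n ∣A∣≤∣B∣ in indPair-≤ k A B indA indB eq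
  ... | inj₂ ∣B∣≤∣A∣ =
    let (k , eq) = m≤n⇒∃[o]m+o≡n ∣B∣≤∣A∣
        (π , pairing , ind) = indPair-≤ k B A indB indA eq
        pairing′ = pairing-sym pairing
    in π , pairing′ , λ Z t → ind Z (transversal-sym pairing′ t)

SBRO⇒IndPairing : (M : Matroid n) → SBRO M → IndPairing M
SBRO⇒IndPairing M = EqPairing⇒IndPairing M ∘ BasePairing⇒EqPairing M ∘ SBRO⇒BasePairing M

IndPairing⇒SBRO : (M : Matroid n) → IndPairing M → SBRO M
IndPairing⇒SBRO M = BasePairing⇒SBRO M ∘ IndPairing⇒BasePairing M

-- Duals and truncations.

module _ (M M* : Matroid n) (isDual : IsDual M M*) where

  open Equivalence

  -- `A` avoids a basis `B`. A point of `∁ A` outside `B` could be added to `A` while still avoiding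
  -- `B`, against the maximality of `A`.
  dual-basis⇒basis-∁ : ∀ {A} → IsBasis M* A → IsBasis M (∁ A)
  dual-basis⇒basis-∁ {A} (indA , maxA) with to (isDual A) indA
  ... | B , basisB , A⊆∁B = subst (IsBasis M) (⊆-antisym B⊆∁A ∁A⊆B) basisB
    where
    B⊆∁A : B ⊆ ∁ A
    B⊆∁A x∈B = x∉p⇒x∈∁p (λ x∈A → x∈∁p⇒x∉p (A⊆∁B x∈A) x∈B)

    ∁A⊆B : ∁ A ⊆ B
    ∁A⊆B {x} x∈∁A = decidable-stable (x ∈? B) λ x∉B →
      maxA x (x∈∁p⇒x∉p x∈∁A) (from (isDual _) (B , basisB , λ y∈ →
        [ A⊆∁B , (λ y∈x → subst (_∈ ∁ B) (sym (x∈⁅y⁆⇒x≡y x y∈x)) (x∉p⇒x∈∁p x∉B)) ]′ (x∈p∪q⁻ A ⁅ x ⁆ y∈)))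

  basis-∁⇒dual-basis : ∀ {Z} → IsBasis M (∁ Z) → IsBasis M* Z
  basis-∁⇒dual-basis {Z} basis∁Z =
    from (isDual Z) (∁ Z , basis∁Z , λ x∈Z → x∉p⇒x∈∁p (x∈p⇒x∉∁p x∈Z)) , max
    where
    max : ∀ x → x ∉ Z → ¬ Ind M* (Z ∪ ⁅ x ⁆)
    max x x∉Z indZx with to (isDual _) indZx
    -- `B` avoids `Z ∪ ⁅ x ⁆`, so `B ∪ ⁅ x ⁆` lies in the basis `∁ Z` and is independent, against
    -- the maximality of `B`.
    ... | B , (_ , maxB) , Zx⊆∁B = maxB x (x∈∁p⇒x∉p (Zx⊆∁B (∈-insert Z x)))
      (ind-⊆ M (λ y∈ → [ (λ y∈B → x∉p⇒x∈∁p (λ y∈Z → x∈∁p⇒x∉p (Zx⊆∁B (∈-insert⁺ Z y∈Z)) y∈B))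
                       , (λ y∈x → subst (_∈ ∁ Z) (sym (x∈⁅y⁆⇒x≡y x y∈x)) (x∉p⇒x∈∁p x∉Z)) ]′ (x∈p∪q⁻ B ⁅ x ⁆ y∈))
               (proj₁ basis∁Z))

  -- The same `π` works: complementation keeps the symmetric difference and turns transversals into
  -- transversals.
  dual-BasePairing : BasePairing M → BasePairing M*
  dual-BasePairing pairs A B basisA basisB
    with π , pairing , bases ← pairs (∁ A) (∁ B) (dual-basis⇒basis-∁ basisA) (dual-basis⇒basis-∁ basisB) =
    π , record { involutive = involutive ; moved = swap∁ ∘ moved } ,
    λ Z t → basis-∁⇒dual-basis (bases (∁ Z) (∁-transversal t))
    where
    open Pairing pairing

    swap∁ : ∀ {x} → Differ (∁ A) (∁ B) x → Differ A B x
    swap∁ (inj₁ (x∈∁A , x∉∁B)) = inj₂ (x∉∁p⇒x∈p x∉∁B , x∈∁p⇒x∉p x∈∁A)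
    swap∁ (inj₂ (x∈∁B , x∉∁A)) = inj₁ (x∉∁p⇒x∈p x∉∁A , x∈∁p⇒x∉p x∈∁B)

    ∁-transversal : ∀ {Z} → Transversal A B π Z → Transversal (∁ A) (∁ B) π (∁ Z)
    ∁-transversal {Z} t = record
      { ∩⊆      = λ x∈∁A x∈∁B → x∉p⇒x∈∁p ([ x∈∁p⇒x∉p x∈∁A , x∈∁p⇒x∉p x∈∁B ]′ ∘ ⊆∪)
      ; ⊆∪      = ∁⊆∪
      ; atMost  = λ m x∈ → x∈p⇒x∉∁p (atLeast m (x∈∁p⇒x∉p x∈))
      ; atLeast = λ m x∉ → x∉p⇒x∈∁p (atMost m (x∉∁p⇒x∈p x∉))
      }
      where
      open Transversal t
      ∁⊆∪ : ∀ {x} → x ∈ ∁ Z → x ∈ ∁ A ⊎ x ∈ ∁ B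
      ∁⊆∪ {x} x∈∁Z with x ∈? A
      ... | yes x∈A = inj₂ (x∉p⇒x∈∁p (λ x∈B → x∈∁p⇒x∉p x∈∁Z (∩⊆ x∈A x∈B)))
      ... | no  x∉A = inj₁ (x∉p⇒x∈∁p x∉A)

duals : SBRO-ClosedUnderDuals
duals M M* isDual = BasePairing⇒SBRO M* ∘ dual-BasePairing M M* isDual ∘ SBRO⇒BasePairing M

-- Bases of `T` are independent sets of `M` of one common size at most `k`. `EqPairing` keeps
-- transversals at that size, so they are independent in `T` and as large as a basis.
truncations : SBRO-ClosedUnderTruncations
truncations M k T isTrunc sbro = BasePairing⇒SBRO T λ A B basisA basisB →
  let (indA , ∣A∣≤k) = to (isTrunc A) (proj₁ basisA)
      (indB , _)     = to (isTrunc B) (proj₁ basisB)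
      (π , pairing , ind) = BasePairing⇒EqPairing M (SBRO⇒BasePairing M sbro) A B indA indB (bases-∣∣≡ T basisA basisB)
  in π , pairing , λ Z t → let (indZ , ∣Z∣≡∣A∣) = ind Z t in
     ind-∣∣≥basis⇒basis T basisA (from (isTrunc Z) (indZ , subst (_≤ k) (sym ∣Z∣≡∣A∣) ∣A∣≤k)) (≤-reflexive (sym ∣Z∣≡∣A∣))
  where open Equivalence

-- Direct sums.

module _ {m k : ℕ} where

  +-elim : ∀ {ℓ} (P : Fin (m + k) → Set ℓ) → (∀ i → P (i ↑ˡ k)) → (∀ j → P (m ↑ʳ j)) → ∀ x → P x
  +-elim P left right x with splitAt m x in eq
  ... | inj₁ i = subst P (splitAt⁻¹-↑ˡ eq) (left i)
  ... | inj₂ j = subst P (splitAt⁻¹-↑ʳ eq) (right j)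

  module _ (X : Subset m) (Y : Subset k) where

    ∈-++ˡ⁺ : ∀ {i} → i ∈ X → i ↑ˡ k ∈ X ++ Y
    ∈-++ˡ⁺ {i} i∈ = lookup⇒[]= _ _ (trans (lookup-++ˡ X Y i) ([]=⇒lookup i∈))

    ∈-++ˡ⁻ : ∀ {i} → i ↑ˡ k ∈ X ++ Y → i ∈ X
    ∈-++ˡ⁻ {i} i∈ = lookup⇒[]= _ _ (trans (sym (lookup-++ˡ X Y i)) ([]=⇒lookup i∈))

    ∈-++ʳ⁺ : ∀ {j} → j ∈ Y → m ↑ʳ j ∈ X ++ Y
    ∈-++ʳ⁺ {j} j∈ = lookup⇒[]= _ _ (trans (lookup-++ʳ X Y j) ([]=⇒lookup j∈))

    ∈-++ʳ⁻ : ∀ {j} → m ↑ʳ j ∈ X ++ Y → j ∈ Y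
    ∈-++ʳ⁻ {j} j∈ = lookup⇒[]= _ _ (trans (sym (lookup-++ʳ X Y j)) ([]=⇒lookup j∈))

  _⊕_ : (Fin m → Fin m) → (Fin k → Fin k) → Fin (m + k) → Fin (m + k)
  (π₁ ⊕ π₂) x = [ (λ i → π₁ i ↑ˡ k) , (λ j → m ↑ʳ π₂ j) ]′ (splitAt m x)

  ⊕-ˡ : ∀ π₁ π₂ i → (π₁ ⊕ π₂) (i ↑ˡ k) ≡ π₁ i ↑ˡ k
  ⊕-ˡ π₁ π₂ i rewrite splitAt-↑ˡ m i k = refl

  ⊕-ʳ : ∀ π₁ π₂ j → (π₁ ⊕ π₂) (m ↑ʳ j) ≡ m ↑ʳ π₂ j
  ⊕-ʳ π₁ π₂ j rewrite splitAt-↑ʳ m k j = refl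

  module _ {A₁ B₁ : Subset m} {A₂ B₂ : Subset k} {π₁ : Fin m → Fin m} {π₂ : Fin k → Fin k} where

    private
      A B : Subset (m + k)
      A = A₁ ++ A₂
      B = B₁ ++ B₂

      π : Fin (m + k) → Fin (m + k)
      π = π₁ ⊕ π₂

      πˡ : ∀ i → π (i ↑ˡ k) ≡ π₁ i ↑ˡ k
      πˡ = ⊕-ˡ π₁ π₂

      πʳ : ∀ j → π (m ↑ʳ j) ≡ m ↑ʳ π₂ j
      πʳ = ⊕-ʳ π₁ π₂

    ⊕-pairing : Pairing A₁ B₁ π₁ → Pairing A₂ B₂ π₂ → Pairing A B π
    ⊕-pairing pairing₁ pairing₂ = record
      { involutive = +-elim _
          (λ i → trans (cong π (πˡ i)) (trans (πˡ (π₁ i)) (cong (_↑ˡ k) (involutive pairing₁ i))))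
          (λ j → trans (cong π (πʳ j)) (trans (πʳ (π₂ j)) (cong (m ↑ʳ_) (involutive pairing₂ j))))
      ; moved = λ {x} → +-elim (λ x → π x ≢ x → Differ A B x)
          (λ i mv → differˡ (moved pairing₁ (mv ∘ trans (πˡ i) ∘ cong (_↑ˡ k))))
          (λ j mv → differʳ (moved pairing₂ (mv ∘ trans (πʳ j) ∘ cong (m ↑ʳ_)))) x
      }
      where
      open Pairing
      differˡ : ∀ {i} → Differ A₁ B₁ i → Differ A B (i ↑ˡ k)
      differˡ (inj₁ (∈A , ∉B)) = inj₁ (∈-++ˡ⁺ A₁ A₂ ∈A , ∉B ∘ ∈-++ˡ⁻ B₁ B₂)
      differˡ (inj₂ (∈B , ∉A)) = inj₂ (∈-++ˡ⁺ B₁ B₂ ∈B , ∉A ∘ ∈-++ˡ⁻ A₁ A₂)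

      differʳ : ∀ {j} → Differ A₂ B₂ j → Differ A B (m ↑ʳ j)
      differʳ (inj₁ (∈A , ∉B)) = inj₁ (∈-++ʳ⁺ A₁ A₂ ∈A , ∉B ∘ ∈-++ʳ⁻ B₁ B₂)
      differʳ (inj₂ (∈B , ∉A)) = inj₂ (∈-++ʳ⁺ B₁ B₂ ∈B , ∉A ∘ ∈-++ʳ⁻ A₁ A₂)

    module _ (Z₁ : Subset m) (Z₂ : Subset k) (t : Transversal A B π (Z₁ ++ Z₂)) where

      open Transversal t

      ⊕-transversalˡ : Transversal A₁ B₁ π₁ Z₁
      ⊕-transversalˡ = record
        { ∩⊆ = λ ∈A ∈B → ∈-++ˡ⁻ Z₁ Z₂ (∩⊆ (∈-++ˡ⁺ A₁ A₂ ∈A) (∈-++ˡ⁺ B₁ B₂ ∈B))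
        ; ⊆∪ = λ ∈Z → [ inj₁ ∘ ∈-++ˡ⁻ A₁ A₂ , inj₂ ∘ ∈-++ˡ⁻ B₁ B₂ ]′ (⊆∪ (∈-++ˡ⁺ Z₁ Z₂ ∈Z))
        ; atMost = λ {i} mv ∈Z π∈Z → atMost (mv ∘ ↑ˡ-injective k _ _ ∘ trans (sym (πˡ i))) (∈-++ˡ⁺ Z₁ Z₂ ∈Z)
            (subst (_∈ Z₁ ++ Z₂) (sym (πˡ i)) (∈-++ˡ⁺ Z₁ Z₂ π∈Z))
        ; atLeast = λ {i} mv ∉Z → ∈-++ˡ⁻ Z₁ Z₂ (subst (_∈ Z₁ ++ Z₂) (πˡ i)
            (atLeast (mv ∘ ↑ˡ-injective k _ _ ∘ trans (sym (πˡ i))) (∉Z ∘ ∈-++ˡ⁻ Z₁ Z₂)))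
        }

      ⊕-transversalʳ : Transversal A₂ B₂ π₂ Z₂
      ⊕-transversalʳ = record
        { ∩⊆ = λ ∈A ∈B → ∈-++ʳ⁻ Z₁ Z₂ (∩⊆ (∈-++ʳ⁺ A₁ A₂ ∈A) (∈-++ʳ⁺ B₁ B₂ ∈B))
        ; ⊆∪ = λ ∈Z → [ inj₁ ∘ ∈-++ʳ⁻ A₁ A₂ , inj₂ ∘ ∈-++ʳ⁻ B₁ B₂ ]′ (⊆∪ (∈-++ʳ⁺ Z₁ Z₂ ∈Z))
        ; atMost = λ {j} mv ∈Z π∈Z → atMost (mv ∘ ↑ʳ-injective m _ _ ∘ trans (sym (πʳ j))) (∈-++ʳ⁺ Z₁ Z₂ ∈Z)
            (subst (_∈ Z₁ ++ Z₂) (sym (πʳ j)) (∈-++ʳ⁺ Z₁ Z₂ π∈Z))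
        ; atLeast = λ {j} mv ∉Z → ∈-++ʳ⁻ Z₁ Z₂ (subst (_∈ Z₁ ++ Z₂) (πʳ j)
            (atLeast (mv ∘ ↑ʳ-injective m _ _ ∘ trans (sym (πʳ j))) (∉Z ∘ ∈-++ʳ⁻ Z₁ Z₂)))
        }

directSums : SBRO-ClosedUnderDirectSums
directSums {m} {k} M N S isSum sbroM sbroN = IndPairing⇒SBRO S pairs
  where
  open Equivalence
  pairs : IndPairing S
  pairs A B indA indB with Vec.splitAt m A | Vec.splitAt m B
  ... | A₁ , A₂ , refl | B₁ , B₂ , refl =
    let (indA₁ , indA₂) = to (isSum A₁ A₂) indA
        (indB₁ , indB₂) = to (isSum B₁ B₂) indB
        (π₁ , pairing₁ , ind₁) = SBRO⇒IndPairing M sbroM A₁ B₁ indA₁ indB₁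
        (π₂ , pairing₂ , ind₂) = SBRO⇒IndPairing N sbroN A₂ B₂ indA₂ indB₂
    in π₁ ⊕ π₂ , ⊕-pairing pairing₁ pairing₂ , λ Z t → split Z t ind₁ ind₂
    where
    split : ∀ {π₁ π₂} Z → Transversal (A₁ ++ A₂) (B₁ ++ B₂) (π₁ ⊕ π₂) Z →
            (∀ Z → Transversal A₁ B₁ π₁ Z → Ind M Z) → (∀ Z → Transversal A₂ B₂ π₂ Z → Ind N Z) → Ind S Z
    split Z t ind₁ ind₂ with Vec.splitAt m Z
    ... | Z₁ , Z₂ , refl = from (isSum Z₁ Z₂) (ind₁ Z₁ (⊕-transversalˡ Z₁ Z₂ t) , ind₂ Z₂ (⊕-transversalʳ Z₁ Z₂ t))

-- Minors.

module _ (M : Matroid n) where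

  augment : ∀ {I Y} → Ind M I → Ind M Y →
            ∃[ I⁺ ] (Ind M I⁺ × I ⊆ I⁺ × I⁺ ⊆ I ∪ Y × ∣ Y ∣ ≤ ∣ I⁺ ∣)
  augment {I} {Y} indI indY = go ∣ Y ∣ indI (m≤n+m _ _)
    where
    go : ∀ k {I} → Ind M I → ∣ Y ∣ ≤ ∣ I ∣ + k →
         ∃[ I⁺ ] (Ind M I⁺ × I ⊆ I⁺ × I⁺ ⊆ I ∪ Y × ∣ Y ∣ ≤ ∣ I⁺ ∣)
    go zero {I} indI le = I , indI , id , p⊆p∪q Y , subst (∣ Y ∣ ≤_) (+-identityʳ _) le
    go (suc k) {I} indI le with ∣ Y ∣ ≤? ∣ I ∣
    ... | yes ∣Y∣≤∣I∣ = I , indI , id , p⊆p∪q Y , ∣Y∣≤∣I∣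
    ... | no ∣Y∣≰∣I∣ =
      let (y , y∈Y , y∉I , indIy) = ind-exch M indI indY (≰⇒> ∣Y∣≰∣I∣)
          (I⁺ , indI⁺ , Iy⊆I⁺ , I⁺⊆ , ∣Y∣≤∣I⁺∣) = go k indIy
            (subst (∣ Y ∣ ≤_) (trans (+-suc _ _) (cong (_+ k) (sym (∣p∪⁅x⁆∣≡1+∣p∣ I y∉I)))) le)
      in I⁺ , indI⁺ , Iy⊆I⁺ ∘ ∈-insert⁺ I ,
         (λ x∈ → [ [ p⊆p∪q Y , (λ x∈y → q⊆p∪q I Y (subst (_∈ Y) (sym (x∈⁅y⁆⇒x≡y y x∈y)) y∈Y)) ]′ ∘ x∈p∪q⁻ I ⁅ y ⁆
                 , q⊆p∪q I Y ]′ (x∈p∪q⁻ (I ∪ ⁅ y ⁆) Y (I⁺⊆ x∈))) ,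
         ∣Y∣≤∣I⁺∣

  basisOf-∣∣≤ : ∀ {C J J′} → IsBasisOf M C J → IsBasisOf M C J′ → ∣ J ∣ ≤ ∣ J′ ∣
  basisOf-∣∣≤ (J⊆C , indJ , _) (_ , indJ′ , maxJ′) = ≮⇒≥ λ lt →
    let (y , y∈J , y∉J′ , ind) = ind-exch M indJ′ indJ lt in maxJ′ y (J⊆C y∈J) y∉J′ ind

  -- Augment `J′` from `X ∪ J`. By maximality in `C` nothing new from `J` can enter, so the result
  -- stays inside `X ∪ J′`; its size, at least that of `X ∪ J`, leaves no room for it to be smaller.
  basisOf-swap : ∀ {C J J′ X} → IsBasisOf M C J → IsBasisOf M C J′ → (∀ {x} → x ∈ X → x ∉ C) →
                 Ind M (X ∪ J) → Ind M (X ∪ J′)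
  basisOf-swap {C} {J} {J′} {X} basisJ@(J⊆C , _) basisJ′@(_ , indJ′ , maxJ′) X∩C=∅ indXJ
    with I , indI , J′⊆I , I⊆ , ∣XJ∣≤∣I∣ ← augment indJ′ indXJ =
    ind-⊆ M (⊆∧∣∣≥⇒⊇ I⊆XJ′ (begin
      ∣ X ∪ J′ ∣       ≤⟨ ∣p∪q∣≤∣p∣+∣q∣ X J′ ⟩
      ∣ X ∣ + ∣ J′ ∣   ≤⟨ +-monoʳ-≤ ∣ X ∣ (basisOf-∣∣≤ basisJ′ basisJ) ⟩
      ∣ X ∣ + ∣ J ∣    ≡⟨ disjoint⇒∣p∪q∣≡∣p∣+∣q∣ X J (λ x∈X x∈J → X∩C=∅ x∈X (J⊆C x∈J)) ⟨
      ∣ X ∪ J ∣        ≤⟨ ∣XJ∣≤∣I∣ ⟩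
      ∣ I ∣            ∎)) indI
    where
    open ≤-Reasoning

    insert⊆I : ∀ {x} → x ∈ I → J′ ∪ ⁅ x ⁆ ⊆ I
    insert⊆I {x} x∈I y∈ = [ J′⊆I , (λ y∈x → subst (_∈ I) (sym (x∈⁅y⁆⇒x≡y x y∈x)) x∈I) ]′ (x∈p∪q⁻ J′ ⁅ x ⁆ y∈)

    I⊆XJ′ : I ⊆ X ∪ J′
    I⊆XJ′ {x} x∈I with x ∈? J′
    ... | yes x∈J′ = q⊆p∪q X J′ x∈J′
    ... | no x∉J′ with x∈p∪q⁻ J′ (X ∪ J) (I⊆ x∈I)
    ...   | inj₁ x∈J′ = contradiction x∈J′ x∉J′
    ...   | inj₂ x∈XJ with x∈p∪q⁻ X J x∈XJ
    ...     | inj₁ x∈X = p⊆p∪q J′ x∈X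
    ...     | inj₂ x∈J = contradiction (ind-⊆ M (insert⊆I x∈I) indI) (maxJ′ x (J⊆C x∈J) x∉J′)

-- Once the two sets are witnessed by one basis `J` of `C`, a pairing in `M` of their images joined
-- with `J` moves no element of `J` and pulls back along `e`.
minors : SBRO-ClosedUnderMinors
minors {n} {m} M C D N e (_ , e-inj , range-e , indN) sbro = IndPairing⇒SBRO N pairs
  where
  open Equivalence

  e∉C : ∀ x → e x ∉ C
  e∉C x ex∈C = x∈∁p⇒x∉p (subst (e x ∈_) range-e (∈-range⁺ e refl)) (p⊆p∪q D ex∈C)

  image∉C : ∀ {X x} → x ∈ image e X → x ∉ C
  image∉C x∈ x∈C with ∈-image⁻ e x∈
  ... | u , _ , refl = e∉C u x∈C

  pairs : IndPairing N
  pairs A B indA indB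
    with J , basisJ , indAJ ← to (indN A) indA
       | J′ , basisJ′ , indBJ′ ← to (indN B) indB
    with π , pairing , ind ← SBRO⇒IndPairing M sbro (image e A ∪ J) (image e B ∪ J) indAJ
                               (basisOf-swap M basisJ′ basisJ image∉C indBJ′)
    = πᴺ , record { involutive = πᴺ-involutive ; moved = πᴺ-moved } ,
      λ Z t → from (indN Z) (J , basisJ , ind _ (lift t))
    where
    open Pairing pairing

    ∈⁺ : ∀ {X x} → x ∈ X → e x ∈ image e X ∪ J
    ∈⁺ x∈X = p⊆p∪q J (∈-image⁺ e x∈X refl)

    ∈⁻ : ∀ {X x} → e x ∈ image e X ∪ J → x ∈ X
    ∈⁻ {X} {x} ex∈ with x∈p∪q⁻ (image e X) J ex∈
    ... | inj₂ ex∈J = contradiction (proj₁ basisJ ex∈J) (e∉C x)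
    ... | inj₁ ex∈ with ∈-image⁻ e ex∈
    ...   | u , u∈X , eu≡ex = subst (_∈ X) (e-inj _ _ eu≡ex) u∈X

    ∖J : ∀ {X y} → y ∈ image e X ∪ J → y ∉ J → ∃[ x ] (e x ≡ y)
    ∖J {X} y∈ y∉J with x∈p∪q⁻ (image e X) J y∈
    ... | inj₁ y∈ = let (x , _ , eq) = ∈-image⁻ e y∈ in x , eq
    ... | inj₂ y∈J = contradiction y∈J y∉J

    moved-in-range : ∀ {y} → π y ≢ y → ∃[ x ] (e x ≡ y)
    moved-in-range mv with moved mv
    ... | inj₁ (y∈ , y∉) = ∖J y∈ (y∉ ∘ q⊆p∪q (image e B) J)
    ... | inj₂ (y∈ , y∉) = ∖J y∈ (y∉ ∘ q⊆p∪q (image e A) J)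

    -- If `e x` is moved then so is `π (e x)`, which therefore lies in the symmetric difference,
    -- outside `J`, and so in the range of `e`.
    restrict : ∀ x → ∃[ y ] (e y ≡ π (e x))
    restrict x with π (e x) ≟F e x
    ... | yes fixed = x , sym fixed
    ... | no mv     = moved-in-range (π-moved pairing mv)

    πᴺ : Fin m → Fin m
    πᴺ = proj₁ ∘ restrict

    e∘πᴺ : ∀ x → e (πᴺ x) ≡ π (e x)
    e∘πᴺ = proj₂ ∘ restrict

    πᴺ-involutive : ∀ x → πᴺ (πᴺ x) ≡ x
    πᴺ-involutive x = e-inj _ _ (trans (e∘πᴺ (πᴺ x)) (trans (cong π (e∘πᴺ x)) (involutive (e x))))

    e-moved : ∀ {x} → πᴺ x ≢ x → π (e x) ≢ e x
    e-moved mv eq = mv (e-inj _ _ (trans (e∘πᴺ _) eq))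

    πᴺ-moved : ∀ {x} → πᴺ x ≢ x → Differ A B x
    πᴺ-moved mv with moved (e-moved mv)
    ... | inj₁ (∈A , ∉B) = inj₁ (∈⁻ ∈A , ∉B ∘ ∈⁺)
    ... | inj₂ (∈B , ∉A) = inj₂ (∈⁻ ∈B , ∉A ∘ ∈⁺)

    lift : ∀ {Z} → Transversal A B πᴺ Z → Transversal (image e A ∪ J) (image e B ∪ J) π (image e Z ∪ J)
    lift {Z} t = record { ∩⊆ = ∩⊆′ ; ⊆∪ = ⊆∪′ ; atMost = atMost′ ; atLeast = atLeast′ }
      where
      open Transversal t

      ∩⊆′ : ∀ {y} → y ∈ image e A ∪ J → y ∈ image e B ∪ J → y ∈ image e Z ∪ J
      ∩⊆′ {y} y∈A y∈B with y ∈? J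
      ... | yes y∈J = q⊆p∪q (image e Z) J y∈J
      ... | no y∉J with ∖J y∈A y∉J
      ...   | x , refl = ∈⁺ (∩⊆ (∈⁻ y∈A) (∈⁻ y∈B))

      ⊆∪′ : ∀ {y} → y ∈ image e Z ∪ J → y ∈ image e A ∪ J ⊎ y ∈ image e B ∪ J
      ⊆∪′ {y} y∈ with y ∈? J
      ... | yes y∈J = inj₁ (q⊆p∪q (image e A) J y∈J)
      ... | no y∉J with ∖J y∈ y∉J
      ...   | x , refl = [ inj₁ ∘ ∈⁺ , inj₂ ∘ ∈⁺ ]′ (⊆∪ (∈⁻ y∈))

      atMost′ : ∀ {y} → π y ≢ y → y ∈ image e Z ∪ J → π y ∉ image e Z ∪ J
      atMost′ mv y∈ πy∈ with moved-in-range mv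
      ... | x , refl = atMost (λ eq → mv (trans (sym (e∘πᴺ x)) (cong e eq))) (∈⁻ y∈)
        (∈⁻ (subst (_∈ image e Z ∪ J) (sym (e∘πᴺ x)) πy∈))

      atLeast′ : ∀ {y} → π y ≢ y → y ∉ image e Z ∪ J → π y ∈ image e Z ∪ J
      atLeast′ mv y∉ with moved-in-range mv
      ... | x , refl = subst (_∈ image e Z ∪ J) (e∘πᴺ x)
        (∈⁺ (atLeast (λ eq → mv (trans (sym (e∘πᴺ x)) (cong e eq))) (y∉ ∘ ∈⁺)))

-- Contracting the alternating paths of two matchings.

Involutive : {E : Set} → (E → E) → Set
Involutive f = ∀ x → f (f x) ≡ x

-- An involution stands for the matching of its moved points; `c` is then a proper 2-colouring of
-- that matching.
Flips : {E : Set} → (E → E) → (E → Bool) → Set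
Flips f c = ∀ {x} → f x ≢ x → c (f x) ≡ not (c x)

module TwoInvolutions {E : Set} (_≟_ : DecidableEquality E) where

  -- The graph with edges {x , ρ x} and {x , μ x} consists of paths and even
  -- cycles; π pairs the ends of those paths both of whose ends are fixed by ρ.
  record Contraction (ρ μ : E → E) : Set where
    field
      π            : E → E
      π-involutive : Involutive π
      ρ-moved      : ∀ {x} → ρ x ≢ x → π x ≡ x
      μ-fixed      : ∀ {x} → μ x ≡ x → π x ≡ x
      -- A path whose two ends are fixed by `ρ` begins and ends with a `μ`-edge, so it has an odd
      -- number of edges and a proper 2-colouring gives its ends opposite colours, just as
      -- `Flips π c` demands.
      extend       : ∀ c → Flips π c → ∃[ c′ ] ((∀ {x} → ρ x ≡ x → c′ x ≡ c x) × Flips ρ c′ × Flips μ c′)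

  -- The inductive step of `contract`: the `ρ`-edge between `e` and `f` is deleted and both points
  -- become isolated, while `μ′` bridges the gap, so that the path through them loses two vertices.
  module RemovePair (ρ μ : E → E) (ρ-involutive : Involutive ρ) (μ-involutive : Involutive μ)
                    (e : E) (ρe≢e : ρ e ≢ e) where

    f : E
    f = ρ e

    End : E → Set
    End y = y ≡ e ⊎ y ≡ f

    end? : ∀ y → Dec (End y)
    end? y = (y ≟ e) ⊎-dec (y ≟ f)

    ρ-End : ∀ {y} → End y → End (ρ y)
    ρ-End (inj₁ refl) = inj₂ refl
    ρ-End (inj₂ refl) = inj₁ (ρ-involutive e)

    ρ-¬End : ∀ {y} → ¬ End y → ¬ End (ρ y)
    ρ-¬End ¬end end = ¬end (subst End (ρ-involutive _) (ρ-End end))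

    ρ-End-moved : ∀ {y} → End y → ρ y ≢ y
    ρ-End-moved (inj₁ refl) eq = ρe≢e eq
    ρ-End-moved (inj₂ refl) eq = ρe≢e (trans (sym eq) (ρ-involutive e))

    ρ′ : E → E
    ρ′ y with end? y
    ... | yes _ = y
    ... | no _  = ρ y

    ρ′-End : ∀ {y} → End y → ρ′ y ≡ y
    ρ′-End {y} end with end? y
    ... | yes _   = refl
    ... | no ¬end = contradiction end ¬end

    ρ′-¬End : ∀ {y} → ¬ End y → ρ′ y ≡ ρ y
    ρ′-¬End {y} ¬end with end? y
    ... | yes end = contradiction end ¬end
    ... | no _    = refl

    ρ′-involutive : Involutive ρ′
    ρ′-involutive y = cases (end? y)
      where
      cases : Dec (End y) → ρ′ (ρ′ y) ≡ y
      cases (yes end) = trans (cong ρ′ (ρ′-End end)) (ρ′-End end)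
      cases (no ¬end) = trans (cong ρ′ (ρ′-¬End ¬end)) (trans (ρ′-¬End (ρ-¬End ¬end)) (ρ-involutive y))

    -- The path μ e – e – f – μ f is replaced by a single edge.
    μ′ : E → E
    μ′ y with end? y | end? (μ y) | end? (μ (ρ (μ y)))
    ... | yes _ | _     | _     = y
    ... | no _  | no _  | _     = μ y
    -- The path ends just beyond the removed edge, so `y` becomes its new end.
    ... | no _  | yes _ | yes _ = y
    ... | no _  | yes _ | no _  = μ (ρ (μ y))

    μ′-End : ∀ {y} → End y → μ′ y ≡ y
    μ′-End {y} end with end? y
    ... | yes _   = refl
    ... | no ¬end = contradiction end ¬end

    μ′-direct : ∀ {y} → ¬ End y → ¬ End (μ y) → μ′ y ≡ μ y
    μ′-direct {y} ¬end ¬endμ with end? y | end? (μ y)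
    ... | yes end | _        = contradiction end ¬end
    ... | no _    | no _     = refl
    ... | no _    | yes endμ = contradiction endμ ¬endμ

    μ′-stop : ∀ {y} → ¬ End y → End (μ y) → End (μ (ρ (μ y))) → μ′ y ≡ y
    μ′-stop {y} ¬end endμ endμρμ with end? y | end? (μ y) | end? (μ (ρ (μ y)))
    ... | yes end | _        | _          = contradiction end ¬end
    ... | no _    | no ¬endμ | _          = contradiction endμ ¬endμ
    ... | no _    | yes _    | yes _      = refl
    ... | no _    | yes _    | no ¬endμρμ = contradiction endμρμ ¬endμρμ

    μ′-through : ∀ {y} → ¬ End y → End (μ y) → ¬ End (μ (ρ (μ y))) → μ′ y ≡ μ (ρ (μ y))
    μ′-through {y} ¬end endμ ¬endμρμ with end? y | end? (μ y) | end? (μ (ρ (μ y)))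
    ... | yes end | _        | _          = contradiction end ¬end
    ... | no _    | no ¬endμ | _          = contradiction endμ ¬endμ
    ... | no _    | yes _    | yes endμρμ = contradiction endμρμ ¬endμρμ
    ... | no _    | yes _    | no _       = refl

    μ′-involutive : Involutive μ′
    μ′-involutive y = cases (end? y) (end? (μ y)) (end? (μ (ρ (μ y))))
      where
      cases : Dec (End y) → Dec (End (μ y)) → Dec (End (μ (ρ (μ y)))) → μ′ (μ′ y) ≡ y
      cases (yes end) _ _ = trans (cong μ′ (μ′-End end)) (μ′-End end)
      cases (no ¬end) (no ¬endμ) _ = trans (cong μ′ (μ′-direct ¬end ¬endμ))
        (trans (μ′-direct ¬endμ (¬end ∘ subst End (μ-involutive y))) (μ-involutive y))
      cases (no ¬end) (yes endμ) (yes endμρμ) =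
        trans (cong μ′ (μ′-stop ¬end endμ endμρμ)) (μ′-stop ¬end endμ endμρμ)
      cases (no ¬end) (yes endμ) (no ¬endμρμ) = trans (cong μ′ (μ′-through ¬end endμ ¬endμρμ))
        (trans (μ′-through ¬endμρμ (subst End (sym (μ-involutive _)) (ρ-End endμ)) (¬end ∘ subst End back)) back)
        where
        back : μ (ρ (μ (μ (ρ (μ y))))) ≡ y
        back = trans (cong (μ ∘ ρ) (μ-involutive _)) (trans (cong μ (ρ-involutive _)) (μ-involutive y))

    μ′-fixed : ∀ {y} → μ y ≡ y → μ′ y ≡ y
    μ′-fixed {y} fixed = cases (end? y)
      where
      cases : Dec (End y) → μ′ y ≡ y
      cases (yes end) = μ′-End end
      cases (no ¬end) = trans (μ′-direct ¬end (¬end ∘ subst End fixed)) fixed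

    module _ (c : E → Bool) (flipsρ′ : Flips ρ′ c) (flipsμ′ : Flips μ′ c) where

      -- `e` is to receive `t` and `f` its negation, which each outer neighbour may constrain. If
      -- both do, the constraints agree because `μ′` joins these neighbours and `c` flips along it.
      colour-e : ∃[ t ] ((¬ End (μ e) → c (μ e) ≡ not t) × (¬ End (μ f) → c (μ f) ≡ t))
      colour-e with end? (μ e) | end? (μ f)
      -- There is no outer neighbour, so either colour would do.
      ... | yes endμe | yes endμf = true , contradiction endμe , contradiction endμf
      ... | yes endμe | no ¬endμf = c (μ f) , contradiction endμe , λ _ → refl
      ... | no ¬endμe | yes endμf = not (c (μ e)) , (λ _ → sym (not-involutive _)) , contradiction endμf
      ... | no ¬endμe | no ¬endμf = not (c (μ e)) , (λ _ → sym (not-involutive _)) , λ _ →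
        trans (cong c (sym through)) (flipsμ′ μ′-moves)
        where
        ρμμe≡f : ρ (μ (μ e)) ≡ f
        ρμμe≡f = cong ρ (μ-involutive e)

        through : μ′ (μ e) ≡ μ f
        through = trans (μ′-through ¬endμe (subst End (sym (μ-involutive e)) (inj₁ refl))
                    (¬endμf ∘ subst (End ∘ μ) ρμμe≡f)) (cong μ ρμμe≡f)

        μ′-moves : μ′ (μ e) ≢ μ e
        μ′-moves eq = ρe≢e (trans (sym (μ-involutive f)) (trans (cong μ (trans (sym through) eq)) (μ-involutive e)))

      t : Bool
      t = proj₁ colour-e

      recolour : E → Bool
      recolour y with y ≟ e | y ≟ f
      ... | yes _ | _     = t
      ... | no _  | yes _ = not t
      ... | no _  | no _  = c y

      recolour-e : recolour e ≡ t
      recolour-e with e ≟ e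
      ... | yes _  = refl
      ... | no e≢e = contradiction refl e≢e

      recolour-f : recolour f ≡ not t
      recolour-f with f ≟ e | f ≟ f
      ... | yes f≡e | _      = contradiction f≡e ρe≢e
      ... | no _    | yes _  = refl
      ... | no _    | no f≢f = contradiction refl f≢f

      recolour-¬End : ∀ {y} → ¬ End y → recolour y ≡ c y
      recolour-¬End {y} ¬end with y ≟ e | y ≟ f
      ... | yes y≡e | _       = contradiction (inj₁ y≡e) ¬end
      ... | no _    | yes y≡f = contradiction (inj₂ y≡f) ¬end
      ... | no _    | no _    = refl

      recolour-flipsρ : Flips ρ recolour
      recolour-flipsρ {y} moved = cases (end? y)
        where
        cases : Dec (End y) → recolour (ρ y) ≡ not (recolour y)
        cases (yes (inj₁ refl)) = trans recolour-f (cong not (sym recolour-e))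
        cases (yes (inj₂ refl)) = trans (cong recolour (ρ-involutive e))
          (trans recolour-e (trans (sym (not-involutive t)) (cong not (sym recolour-f))))
        cases (no ¬end) = trans (recolour-¬End (ρ-¬End ¬end)) (trans (cong c (sym (ρ′-¬End ¬end)))
          (trans (flipsρ′ (moved ∘ trans (sym (ρ′-¬End ¬end)))) (cong not (sym (recolour-¬End ¬end)))))

      recolour-μ-End : ∀ {y} → End y → ¬ End (μ y) → recolour (μ y) ≡ not (recolour y)
      recolour-μ-End (inj₁ refl) ¬endμ = trans (recolour-¬End ¬endμ)
        (trans (proj₁ (proj₂ colour-e) ¬endμ) (cong not (sym recolour-e)))
      recolour-μ-End (inj₂ refl) ¬endμ = trans (recolour-¬End ¬endμ)
        (trans (proj₂ (proj₂ colour-e) ¬endμ) (trans (sym (not-involutive t)) (cong not (sym recolour-f))))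

      recolour-flipsμ : Flips μ recolour
      recolour-flipsμ {y} moved = cases (end? y) (end? (μ y))
        where
        cases : Dec (End y) → Dec (End (μ y)) → recolour (μ y) ≡ not (recolour y)
        cases (yes (inj₁ refl)) (yes (inj₁ μe≡e)) = contradiction μe≡e moved
        cases (yes (inj₁ refl)) (yes (inj₂ μe≡f)) = trans (cong recolour μe≡f) (trans recolour-f (cong not (sym recolour-e)))
        cases (yes (inj₂ refl)) (yes (inj₁ μf≡e)) = trans (cong recolour μf≡e)
          (trans recolour-e (trans (sym (not-involutive t)) (cong not (sym recolour-f))))
        cases (yes (inj₂ refl)) (yes (inj₂ μf≡f)) = contradiction μf≡f moved
        cases (yes end) (no ¬endμ) = recolour-μ-End end ¬endμ
        cases (no ¬end) (yes endμ) = trans (sym (not-involutive _))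
          (cong not (trans (sym (recolour-μ-End endμ (¬end ∘ subst End (μ-involutive y)))) (cong recolour (μ-involutive y))))
        cases (no ¬end) (no ¬endμ) = trans (recolour-¬End ¬endμ) (trans (cong c (sym (μ′-direct ¬end ¬endμ)))
          (trans (flipsμ′ (moved ∘ trans (sym (μ′-direct ¬end ¬endμ)))) (cong not (sym (recolour-¬End ¬end)))))

    -- `π` is kept. It fixes `e` and `f`, since `μ′` does. Points fixed by `ρ` are neither `e` nor
    -- `f`, so recolouring leaves their colours alone.
    restore : Contraction ρ′ μ′ → Contraction ρ μ
    restore contraction = record
      { π            = π
      ; π-involutive = π-involutive
      ; ρ-moved      = λ {y} → ρ-moved′ {y}
      ; μ-fixed      = μ-fixed ∘ μ′-fixed
      ; extend       = extend′
      }
      where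
      open Contraction contraction

      ρ-moved′ : ∀ {y} → ρ y ≢ y → π y ≡ y
      ρ-moved′ {y} moved = cases (end? y)
        where
        cases : Dec (End y) → π y ≡ y
        cases (yes end) = μ-fixed (μ′-End end)
        cases (no ¬end) = ρ-moved (moved ∘ trans (sym (ρ′-¬End ¬end)))

      extend′ : ∀ c → Flips π c → ∃[ c′ ] ((∀ {x} → ρ x ≡ x → c′ x ≡ c x) × Flips ρ c′ × Flips μ c′)
      extend′ c flips with extend c flips
      ... | c′ , agree , flipsρ′ , flipsμ′ =
        recolour c′ flipsρ′ flipsμ′ ,
        (λ fixed → let ¬end = λ end → ρ-End-moved end fixed in
          trans (recolour-¬End c′ flipsρ′ flipsμ′ ¬end) (agree (trans (ρ′-¬End ¬end) fixed))) ,
        recolour-flipsρ c′ flipsρ′ flipsμ′ ,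
        recolour-flipsμ c′ flipsρ′ flipsμ′

  -- Induction on a list `L` containing all points moved by `ρ`. When it is empty `ρ` is the
  -- identity, every path is a single `μ`-edge or a point, and `μ` itself pairs the ends.
  contract : ∀ (L : List E) {ρ μ} → Involutive ρ → Involutive μ → (∀ {x} → ρ x ≢ x → x ∈ᴸ L) → Contraction ρ μ
  contract [] {ρ} {μ} ρ-inv μ-inv inL = record
    { π            = μ
    ; π-involutive = μ-inv
    ; ρ-moved      = λ moved → contradiction (inL moved) λ ()
    ; μ-fixed      = id
    ; extend       = λ c flips → c , (λ _ → refl) , (λ moved → contradiction (inL moved) λ ()) , flips
    }
  contract (e ∷ L) {ρ} {μ} ρ-inv μ-inv inL with ρ e ≟ e
  ... | yes ρe≡e = contract L ρ-inv μ-inv λ moved → tail (λ { refl → moved ρe≡e }) (inL moved)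
  ... | no ρe≢e = restore (contract L ρ′-involutive μ′-involutive inL′)
    where
    open RemovePair ρ μ ρ-inv μ-inv e ρe≢e

    inL′ : ∀ {x} → ρ′ x ≢ x → x ∈ᴸ L
    inL′ {x} moved = cases (end? x)
      where
      cases : Dec (End x) → x ∈ᴸ L
      cases (yes end) = contradiction (ρ′-End end) moved
      cases (no ¬end) = tail (¬end ∘ inj₁) (inL (moved ∘ trans (ρ′-¬End ¬end)))

-- Darts and the choices encoded by their 2-colourings.

-- Two copies of the vertex set; the flag tells to which of the two linkings a copy belongs.
Dart : ℕ → Set
Dart n = Fin n × Bool

_≟D_ : DecidableEquality (Dart n)
_≟D_ = ≡-dec _≟F_ _≟B_

allDarts : List (Dart n)
allDarts {n} = cartesianProduct (allFin n) (true ∷ false ∷ [])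

∈-allDarts : (x : Dart n) → x ∈ᴸ allDarts
∈-allDarts (v , p) = ∈-cartesianProduct⁺ (∈-allFin v) (∈-Bool p)
  where
  ∈-Bool : ∀ p → p ∈ᴸ true ∷ false ∷ []
  ∈-Bool true  = here refl
  ∈-Bool false = there (here refl)

module Darts (A B : Subset n) where

  -- The dart (v , false) is present iff v ∉ A, and (v , true) iff v ∉ B.
  side : Bool → Subset n
  side false = A
  side true  = B

  -- For `v` in the symmetric difference this is its only present dart: if `v ∈ A` then `v ∉ B`,
  -- which is the flag `true`.
  dart : Fin n → Dart n
  dart v = v , ⌊ v ∈? A ⌋

  data Status (v : Fin n) : Set where
    both    : v ∈ A → v ∈ B → Status v
    neither : v ∉ A → v ∉ B → Status v
    one     : Differ A B v → Status v

  status : ∀ v → Status v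
  status v with v ∈? A | v ∈? B
  ... | yes v∈A | yes v∈B = both v∈A v∈B
  ... | no v∉A  | no v∉B  = neither v∉A v∉B
  ... | yes v∈A | no v∉B  = one (inj₁ (v∈A , v∉B))
  ... | no v∉A  | yes v∈B = one (inj₂ (v∈B , v∉A))

  both⇒∈side : ∀ {v} p → v ∈ A → v ∈ B → v ∈ side p
  both⇒∈side false v∈A _ = v∈A
  both⇒∈side true  _ v∈B = v∈B

  ∉side⇒dart : ∀ {v} p → Differ A B v → v ∉ side p → (v , p) ≡ dart v
  ∉side⇒dart {v} p d v∉ with v ∈? A
  ∉side⇒dart true  _ _                  | yes _   = refl
  ∉side⇒dart false _ v∉A                | yes v∈A = contradiction v∈A v∉A
  ∉side⇒dart false _ _                  | no _    = refl
  ∉side⇒dart true  (inj₁ (v∈A , _)) _   | no v∉A  = contradiction v∈A v∉A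
  ∉side⇒dart true  (inj₂ (v∈B , _)) v∉B | no _    = contradiction v∈B v∉B

  dart-∉side : ∀ {v} → Differ A B v → v ∉ side (proj₂ (dart v))
  dart-∉side {v} d with v ∈? A
  dart-∉side (inj₁ (_ , v∉B))   | yes _   = v∉B
  dart-∉side (inj₂ (_ , v∉A))   | yes v∈A = contradiction v∈A v∉A
  dart-∉side _                  | no v∉A  = v∉A

  module Turn {π : Fin n → Fin n} (pairing : Pairing A B π) where

    open Pairing pairing

    abstract
      -- Absent darts stay put, the two present darts of a vertex in neither set are matched with
      -- each other, and a lone present dart is matched with that of the partner vertex. For the
      -- identity pairing lone darts are fixed.
      turn : Dart n → Dart n
      turn (v , p) with v ∈? side p | v ∈? side (not p)
      ... | yes _ | _     = v , p
      ... | no _  | no _  = v , not p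
      ... | no _  | yes _ = dart (π v)

      turn-∈ : ∀ {v} p → v ∈ side p → turn (v , p) ≡ (v , p)
      turn-∈ {v} p v∈ with v ∈? side p
      ... | yes _ = refl
      ... | no v∉ = contradiction v∈ v∉

      turn-neither : ∀ {v} p → v ∉ A → v ∉ B → turn (v , p) ≡ (v , not p)
      turn-neither {v} p v∉A v∉B with v ∈? side p | v ∈? side (not p)
      turn-neither {v} false v∉A v∉B | yes v∈A | _       = contradiction v∈A v∉A
      turn-neither {v} true  v∉A v∉B | yes v∈B | _       = contradiction v∈B v∉B
      turn-neither {v} p     v∉A v∉B | no _    | no _    = refl
      turn-neither {v} false v∉A v∉B | no _    | yes v∈B = contradiction v∈B v∉B
      turn-neither {v} true  v∉A v∉B | no _    | yes v∈A = contradiction v∈A v∉A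

      turn-∉∈ : ∀ {v} p → v ∉ side p → v ∈ side (not p) → turn (v , p) ≡ dart (π v)
      turn-∉∈ {v} p v∉ v∈ with v ∈? side p | v ∈? side (not p)
      ... | yes v∈p | _      = contradiction v∈p v∉
      ... | no _    | yes _  = refl
      ... | no _    | no v∉′ = contradiction v∈ v∉′

    one-∈side : ∀ {v} p → Differ A B v → v ∉ side p → v ∈ side (not p)
    one-∈side false (inj₁ (v∈A , _)) v∉A = contradiction v∈A v∉A
    one-∈side false (inj₂ (v∈B , _)) _   = v∈B
    one-∈side true  (inj₁ (v∈A , _)) _   = v∈A
    one-∈side true  (inj₂ (v∈B , _)) v∉B = contradiction v∈B v∉B

    turn-dart : ∀ {v} → Differ A B v → turn (dart v) ≡ dart (π v)
    turn-dart d = turn-∉∈ _ (dart-∉side d) (one-∈side _ d (dart-∉side d))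

    π-Differ : ∀ {v} → Differ A B v → Differ A B (π v)
    π-Differ {v} d with π v ≟F v
    ... | yes eq = subst (Differ A B) (sym eq) d
    ... | no mv  = moved (π-moved pairing mv)

    turn-involutive : Involutive turn
    turn-involutive (v , p) = cases (status v) (v ∈? side p)
      where
      open ≡-Reasoning

      cases : Status v → Dec (v ∈ side p) → turn (turn (v , p)) ≡ (v , p)
      cases _ (yes v∈) = trans (cong turn (turn-∈ p v∈)) (turn-∈ p v∈)
      cases (both v∈A v∈B) (no v∉) = contradiction (both⇒∈side p v∈A v∈B) v∉
      cases (neither v∉A v∉B) (no _) = trans (cong turn (turn-neither p v∉A v∉B))
        (trans (turn-neither (not p) v∉A v∉B) (cong (v ,_) (not-involutive p)))
      cases (one d) (no v∉) = begin
        turn (turn (v , p))   ≡⟨ cong (turn ∘ turn) (∉side⇒dart p d v∉) ⟩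
        turn (turn (dart v))  ≡⟨ cong turn (turn-dart d) ⟩
        turn (dart (π v))     ≡⟨ turn-dart (π-Differ d) ⟩
        dart (π (π v))        ≡⟨ cong dart (involutive v) ⟩
        dart v                ≡⟨ ∉side⇒dart p d v∉ ⟨
        (v , p)               ∎

    module Selection (c : Dart n → Bool) (flips : Flips turn c) where

      -- Colour `true` on a present dart means that at `v` the new linking uses the linking named by
      -- the flag.
      Selected : Fin n → Bool → Set
      Selected v p = v ∉ side p × c (v , p) ≡ true

      -- If both darts of `v` are present, `turn` swaps them, so only one of them has colour `true`.
      selected-unique : ∀ {v} p q → Selected v p → Selected v q → p ≡ q
      selected-unique false false _ _ = refl
      selected-unique true  true  _ _ = refl
      selected-unique {v} false true (v∉A , cA) (v∉B , cB) =
        contradiction (trans (sym cB) (trans (cong c (sym eq)) (trans (flips moves) (cong not cA)))) λ ()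
        where
        eq : turn (v , false) ≡ (v , true)
        eq = turn-neither false v∉A v∉B
        moves : turn (v , false) ≢ (v , false)
        moves eq′ = contradiction (cong proj₂ (trans (sym eq) eq′)) λ ()
      selected-unique true false selB selA = sym (selected-unique false true selA selB)

      -- The vertices without a selected dart, in decidable form. A vertex in neither set never
      -- qualifies, as one of its two darts has colour `true`.
      InUnselected : Fin n → Set
      InUnselected v = v ∈ A × v ∈ B ⊎ Differ A B v × c (dart v) ≡ false

      unselected? : ∀ v → Dec (InUnselected v)
      unselected? v = ((v ∈? A) ×-dec (v ∈? B)) ⊎-dec
        ((((v ∈? A) ×-dec ¬? (v ∈? B)) ⊎-dec ((v ∈? B) ×-dec ¬? (v ∈? A))) ×-dec (c (dart v) ≟B false))

      unselected : Subset n
      unselected = select unselected?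

      ∉unselected⇒selected : ∀ {v} → v ∉ unselected → ∃[ p ] Selected v p
      ∉unselected⇒selected {v} v∉ with status v
      ... | both v∈A v∈B = contradiction (∈-select⁺ unselected? (inj₁ (v∈A , v∈B))) v∉
      ... | one d = proj₂ (dart v) , dart-∉side d ,
        ¬-not (λ eq → v∉ (∈-select⁺ unselected? (inj₂ (d , eq))))
      ... | neither v∉A v∉B with c (v , false) in eq
      ...   | true  = false , v∉A , eq
      ...   | false = true , v∉B , trans (cong c (sym (turn-neither false v∉A v∉B)))
        (trans (flips moves) (cong not eq))
        where
        moves : turn (v , false) ≢ (v , false)
        moves eq′ = contradiction (cong proj₂ (trans (sym (turn-neither false v∉A v∉B)) eq′)) λ ()

      -- `turn` matches the lone darts of two paired vertices, so these get opposite colours and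
      -- exactly one of the two vertices is unselected.
      unselected-transversal : Transversal A B π unselected
      unselected-transversal = record
        { ∩⊆      = λ v∈A v∈B → ∈-select⁺ unselected? (inj₁ (v∈A , v∈B))
        ; ⊆∪      = λ v∈ → [ inj₁ ∘ proj₁ , [ inj₁ ∘ proj₁ , inj₂ ∘ proj₁ ]′ ∘ proj₁ ]′ (∈-select⁻ unselected? v∈)
        ; atMost  = λ mv v∈ πv∈ → contradiction
            (trans (sym (dart-colour (moved (π-moved pairing mv)) πv∈)) (trans (dart-flips mv) (cong not (dart-colour (moved mv) v∈))))
            λ ()
        ; atLeast = λ mv v∉ → ∈-select⁺ unselected? (inj₂ (moved (π-moved pairing mv) ,
            trans (dart-flips mv) (cong not (¬-not (λ eq → v∉ (∈-select⁺ unselected? (inj₂ (moved mv , eq))))))))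
        }
        where
        dart-flips : ∀ {v} → π v ≢ v → c (dart (π v)) ≡ not (c (dart v))
        dart-flips mv = trans (cong c (sym (turn-dart (moved mv))))
          (flips (λ eq → mv (cong proj₁ (trans (sym (turn-dart (moved mv))) eq))))

        dart-colour : ∀ {v} → Differ A B v → v ∈ unselected → c (dart v) ≡ false
        dart-colour d v∈ with ∈-select⁻ unselected? v∈
        ... | inj₁ v∈∩ = contradiction (x∈p∩q⁺ v∈∩) (Differ⇒∉∩ A B d)
        ... | inj₂ (_ , eq) = eq

-- Linkings as permutations of the vertices.

module Extension {I : Set} (h : I → Fin n) (h-injective : ∀ {i j} → h i ≡ h j → i ≡ j)
                 (h? : ∀ v → Dec (∃[ i ] (h i ≡ v))) where

  extendBy : (I → I) → Fin n → Fin n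
  extendBy f v with h? v
  ... | yes (i , _) = h (f i)
  ... | no _        = v

  extendBy-h : ∀ f i → extendBy f (h i) ≡ h (f i)
  extendBy-h f i with h? (h i)
  ... | yes (j , hj≡hi) = cong (h ∘ f) (h-injective hj≡hi)
  ... | no ∄i           = contradiction (i , refl) ∄i

  extendBy-∉ : ∀ f {v} → ¬ (∃[ i ] (h i ≡ v)) → extendBy f v ≡ v
  extendBy-∉ f {v} ∄i with h? v
  ... | yes ∃i = contradiction ∃i ∄i
  ... | no _   = refl

  extendBy-inverse : ∀ {f g} → (∀ i → g (f i) ≡ i) → ∀ v → extendBy g (extendBy f v) ≡ v
  extendBy-inverse {f} {g} gf v = cases (h? v)
    where
    cases : Dec (∃[ i ] (h i ≡ v)) → extendBy g (extendBy f v) ≡ v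
    cases (yes (i , refl)) = trans (cong (extendBy g) (extendBy-h f i)) (trans (extendBy-h g (f i)) (cong h (gf i)))
    cases (no ∄i) = trans (cong (extendBy g) (extendBy-∉ f ∄i)) (extendBy-∉ g ∄i)

-- Cyclic shifts: stepping past the last position leads back to `zero`, which closes a path into a
-- cycle.
csuc cpred : ∀ {ℓ} → Fin (suc ℓ) → Fin (suc ℓ)
csuc a with view a
... | ‵fromℕ     = zero
... | ‵inject₁ b = suc b
cpred zero    = fromℕ _
cpred (suc a) = inject₁ a

csuc-cpred : ∀ {ℓ} (a : Fin (suc ℓ)) → csuc (cpred a) ≡ a
csuc-cpred {ℓ} zero rewrite view-fromℕ ℓ = refl
csuc-cpred (suc a) rewrite view-inject₁ a = refl

cpred-csuc : ∀ {ℓ} (a : Fin (suc ℓ)) → cpred (csuc a) ≡ a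
cpred-csuc a with view a
... | ‵fromℕ     = refl
... | ‵inject₁ b = refl

-- A system of disjoint paths from X onto Y, as a permutation of the vertices:
-- τ sends each vertex to its predecessor on its path, closing every path into
-- a cycle, and fixes the vertices on no path.
record Routing (G : Digraph n) (X Y : Subset n) : Set where
  field
    τ σ  : Fin n → Fin n
    σ∘τ  : ∀ w → σ (τ w) ≡ w
    τ∘σ  : ∀ v → τ (σ v) ≡ v
    τ-∈  : ∀ {w} → w ∈ X → τ w ∈ Y
    τ-∉  : ∀ {w} → w ∉ X → τ w ∉ Y
    arc  : ∀ {w} → w ∉ X → τ w ≡ w ⊎ G (τ w) w ≡ true

-- `τ` is the cyclic predecessor. It takes the start of a path to its end and any later vertex to
-- one before the end. Vertices on no path are fixed and are not ends, so `τ` matches `X` with the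
-- set of ends.
linked⇒routing : ∀ {s} (G : Digraph n) (N : Matroid s) (ι : Fin s → Fin n) {X} →
                 Linked G N ι X → ∃[ Y ] (Ind N Y × Routing G X (image ι Y))
linked⇒routing {n} {s} G N ι {X} (k , P , T , starts , disjoint , ends , indT) = range T , indT , record
  { τ   = τ
  ; σ   = extendBy succ
  ; σ∘τ = extendBy-inverse {pred} {succ} (λ (i , a) → cong (i ,_) (csuc-cpred a))
  ; τ∘σ = extendBy-inverse {succ} {pred} (λ (i , a) → cong (i ,_) (cpred-csuc a))
  ; τ-∈ = τ-∈′
  ; τ-∉ = τ-∉′
  ; arc = arc′
  }
  where
  open Equivalence

  Position : Set
  Position = Σ (Fin k) λ i → Fin (suc (len (P i)))

  at : Position → Fin n
  at (i , a) = vert (P i) a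

  at-injective : ∀ {x y} → at x ≡ at y → x ≡ y
  at-injective {i , a} {j , b} eq with i ≟F j
  ... | no i≢j  = contradiction eq (disjoint i j i≢j a b)
  ... | yes refl = cong (i ,_) (simple (P i) a b eq)

  at? : ∀ v → Dec (∃[ x ] (at x ≡ v))
  at? v = map′ (λ (i , a , eq) → (i , a) , eq) (λ ((i , a) , eq) → i , a , eq)
    (any? (λ i → any? (λ a → vert (P i) a ≟F v)))

  open Extension at at-injective at?

  pred succ : Position → Position
  pred (i , a) = i , cpred a
  succ (i , a) = i , csuc a

  τ : Fin n → Fin n
  τ = extendBy pred

  Y : Subset n
  Y = image ι (range T)

  end∈Y : ∀ i → end (P i) ∈ Y
  end∈Y i = ∈-image⁺ ι (∈-range⁺ T refl) (ends i)

  ∈Y⁻ : ∀ {v} → v ∈ Y → ∃[ i ] (end (P i) ≡ v)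
  ∈Y⁻ v∈ with ∈-image⁻ ι v∈
  ... | t , t∈ , refl with ∈-range⁻ T t∈
  ...   | i , refl = i , sym (ends i)

  τ-∈′ : ∀ {w} → w ∈ X → τ w ∈ Y
  τ-∈′ {w} w∈X with to (starts w) w∈X
  ... | i , refl = subst (_∈ Y) (sym (extendBy-h pred (i , zero))) (end∈Y i)

  τ-∉′ : ∀ {w} → w ∉ X → τ w ∉ Y
  τ-∉′ {w} w∉X = cases (at? w)
    where
    cases : Dec (∃[ x ] (at x ≡ w)) → τ w ∉ Y
    cases (yes ((i , zero) , eq)) _ = w∉X (from (starts w) (i , eq))
    cases (yes ((i , suc a) , refl)) τw∈ with ∈Y⁻ (subst (_∈ Y) (extendBy-h pred (i , suc a)) τw∈)
    ... | j , eq with j ≟F i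
    ...   | no j≢i   = disjoint j i j≢i _ _ eq
    ...   | yes refl = fromℕ≢inject₁ (simple (P i) _ _ eq)
    cases (no ∄x) τw∈ with ∈Y⁻ (subst (_∈ Y) (extendBy-∉ pred ∄x) τw∈)
    ... | j , eq = ∄x ((j , fromℕ _) , eq)

  arc′ : ∀ {w} → w ∉ X → τ w ≡ w ⊎ G (τ w) w ≡ true
  arc′ {w} w∉X = cases (at? w)
    where
    cases : Dec (∃[ x ] (at x ≡ w)) → τ w ≡ w ⊎ G (τ w) w ≡ true
    cases (yes ((i , zero) , eq)) = contradiction (from (starts w) (i , eq)) w∉X
    cases (yes ((i , suc a) , refl)) = inj₂ (trans (cong (λ v → G v w) (extendBy-h pred (i , suc a))) (arcs (P i) a))
    cases (no ∄x) = inj₁ (extendBy-∉ pred ∄x)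

-- Rerouting two linkings along a transversal.

module Reroute {G : Digraph n} {A B A₀ B₀ : Subset n}
               (routeA : Routing G A A₀) (routeB : Routing G B B₀)
               {π₀ : Fin n → Fin n} (pairing₀ : Pairing A₀ B₀ π₀) where

  private
    module Left  = Darts A₀ B₀
    module Right = Darts A B

    idPairing : Pairing A B id
    idPairing = record { involutive = λ _ → refl ; moved = contradiction refl }

    open Left.Turn pairing₀ using () renaming (turn to turn₀; turn-∈ to turn₀-∈; turn-involutive to turn₀-involutive)
    open Right.Turn idPairing using () renaming (turn to ρ; turn-involutive to ρ-involutive; turn-neither to ρ-neither; turn-dart to ρ-dart)

    routing : ∀ p → Routing G (Right.side p) (Left.side p)
    routing false = routeA
    routing true  = routeB

    module R (p : Bool) = Routing (routing p)

    -- A left dart is a departure from a vertex and a right dart an arrival, joined by one step of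
    -- the linking `p`. `μ` is the matching of departures transported to arrivals.
    toLeft toRight μ : Dart n → Dart n
    toLeft  (w , p) = R.τ p w , p
    toRight (v , p) = R.σ p v , p
    μ = toRight ∘ turn₀ ∘ toLeft

    toRight-toLeft : ∀ x → toRight (toLeft x) ≡ x
    toRight-toLeft (w , p) = cong (_, p) (R.σ∘τ p w)

    toLeft-toRight : ∀ x → toLeft (toRight x) ≡ x
    toLeft-toRight (v , p) = cong (_, p) (R.τ∘σ p v)

    μ-involutive : Involutive μ
    μ-involutive x = begin
      toRight (turn₀ (toLeft (toRight (turn₀ (toLeft x)))))  ≡⟨ cong (toRight ∘ turn₀) (toLeft-toRight (turn₀ (toLeft x))) ⟩
      toRight (turn₀ (turn₀ (toLeft x)))                     ≡⟨ cong toRight (turn₀-involutive (toLeft x)) ⟩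
      toRight (toLeft x)                                     ≡⟨ toRight-toLeft x ⟩
      x                                                      ∎
      where open ≡-Reasoning

    open TwoInvolutions (_≟D_ {n})

    abstract
      contraction : Contraction ρ μ
      contraction = contract allDarts ρ-involutive μ-involutive (λ {x} _ → ∈-allDarts x)

    open Contraction contraction using (π-involutive; ρ-moved; μ-fixed; extend) renaming (π to πᴰ)

    -- An absent dart stays absent under `toLeft` and is fixed by `μ`; a dart of a vertex in neither
    -- set is moved by `ρ`. A contraction fixes both kinds, which leaves the lone darts of the
    -- symmetric difference.
    moved-dart : ∀ {x} → πᴰ x ≢ x → Differ A B (proj₁ x) × x ≡ Right.dart (proj₁ x)
    moved-dart {w , p} mv = cases (Right.status w)
      where
      w∉side : w ∉ Right.side p
      w∉side w∈ = mv (μ-fixed (trans (cong toRight (turn₀-∈ p (R.τ-∈ p w∈))) (toRight-toLeft (w , p))))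

      cases : Right.Status w → Differ A B w × (w , p) ≡ Right.dart w
      cases (Right.both w∈A w∈B) = contradiction (Right.both⇒∈side p w∈A w∈B) w∉side
      cases (Right.neither w∉A w∉B) = contradiction
        (ρ-moved (λ eq → not-¬ {p} refl (cong proj₂ (trans (sym eq) (ρ-neither p w∉A w∉B))))) mv
      cases (Right.one d) = d , Right.∉side⇒dart p d w∉side

    πᴰ-moved : ∀ {x} → πᴰ x ≢ x → πᴰ (πᴰ x) ≢ πᴰ x
    πᴰ-moved mv eq = mv (trans (sym eq) (π-involutive _))

  π : Fin n → Fin n
  π w = proj₁ (πᴰ (Right.dart w))

  private
    moved⇒dart-moved : ∀ {w} → π w ≢ w → πᴰ (Right.dart w) ≢ Right.dart w
    moved⇒dart-moved mv eq = mv (cong proj₁ eq)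

    πᴰ-dart : ∀ {w} → πᴰ (Right.dart w) ≢ Right.dart w → πᴰ (Right.dart w) ≡ Right.dart (π w)
    πᴰ-dart mv = proj₂ (moved-dart (πᴰ-moved mv))

    dart-moved⇒moved : ∀ {w} → πᴰ (Right.dart w) ≢ Right.dart w → π w ≢ w
    dart-moved⇒moved mv eq = mv (trans (πᴰ-dart mv) (cong Right.dart eq))

  pairing : Pairing A B π
  pairing = record { involutive = involutive′ ; moved = λ mv → proj₁ (moved-dart (moved⇒dart-moved mv)) }
    where
    involutive′ : ∀ w → π (π w) ≡ w
    involutive′ w with πᴰ (Right.dart w) ≟D Right.dart w
    ... | yes eq = trans (cong π (cong proj₁ eq)) (cong proj₁ eq)
    ... | no mv  = trans (cong (proj₁ ∘ πᴰ) (sym (πᴰ-dart mv))) (cong proj₁ (π-involutive (Right.dart w)))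

  module _ {Z : Subset n} (t : Transversal A B π Z) where

    open Transversal t

    private
      -- `true` stands for an arrival that is used. Members of `Z` are to be starts, so no step may
      -- arrive there; that `c` flips along `πᴰ` is the transversal property of `Z`.
      c : Dart n → Bool
      c (w , _) = not ⌊ w ∈? Z ⌋

      c-∈ : ∀ {w} p → w ∈ Z → c (w , p) ≡ false
      c-∈ {w} p w∈Z with w ∈? Z
      ... | yes _  = refl
      ... | no w∉Z = contradiction w∈Z w∉Z

      c-∉ : ∀ {w} p → w ∉ Z → c (w , p) ≡ true
      c-∉ {w} p w∉Z with w ∈? Z
      ... | yes w∈Z = contradiction w∈Z w∉Z
      ... | no _    = refl

      c-flips-dart : ∀ w → πᴰ (Right.dart w) ≢ Right.dart w → c (πᴰ (Right.dart w)) ≡ not (c (Right.dart w))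
      c-flips-dart w mv with w ∈? Z
      ... | yes w∈Z = c-∉ (proj₂ (πᴰ (Right.dart w))) (atMost (dart-moved⇒moved mv) w∈Z)
      ... | no w∉Z  = c-∈ (proj₂ (πᴰ (Right.dart w))) (atLeast (dart-moved⇒moved mv) w∉Z)

      c-flips : Flips πᴰ c
      c-flips {x} mv = subst (λ y → c (πᴰ y) ≡ not (c y)) (sym x≡) (c-flips-dart _ (subst (λ y → πᴰ y ≢ y) x≡ mv))
        where
        x≡ : x ≡ Right.dart (proj₁ x)
        x≡ = proj₂ (moved-dart mv)

      abstract
        extended : ∃[ c′ ] ((∀ {x} → ρ x ≡ x → c′ x ≡ c x) × Flips ρ c′ × Flips μ c′)
        extended = extend c c-flips

      c′ : Dart n → Bool
      c′ = proj₁ extended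

      c′-agrees : ∀ {x} → ρ x ≡ x → c′ x ≡ c x
      c′-agrees = proj₁ (proj₂ extended)

      -- A step is either used or not, so its departure has the colour of its arrival.
      c₀ : Dart n → Bool
      c₀ = c′ ∘ toRight

      c₀-flips : Flips turn₀ c₀
      c₀-flips {y} mv = subst (λ z → c′ (toRight (turn₀ z)) ≡ not (c₀ y)) (toLeft-toRight y)
        (proj₂ (proj₂ (proj₂ extended)) λ eq →
          mv (trans (sym (toLeft-toRight _)) (trans (cong (toLeft ∘ toRight ∘ turn₀) (sym (toLeft-toRight y)))
            (trans (cong toLeft eq) (toLeft-toRight y)))))

      module SelL = Left.Turn.Selection pairing₀ c₀ c₀-flips
      module SelR = Right.Turn.Selection idPairing c′ (proj₁ (proj₂ (proj₂ extended)))

      σ-selected : ∀ {v} p → SelL.Selected v p → SelR.Selected (R.σ p v) p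
      σ-selected {v} p (v∉ , c≡) = (λ w∈ → v∉ (subst (_∈ Left.side p) (R.τ∘σ p v) (R.τ-∈ p w∈))) , c≡

      -- A vertex of `Z` with a present dart lies in the symmetric difference. That dart is fixed by
      -- `ρ`, so `c′` agrees there with `c`, which is `false` on `Z`.
      selected⇒∉Z : ∀ {w} p → SelR.Selected w p → w ∉ Z
      selected⇒∉Z {w} p (w∉ , c′≡) w∈Z = cases (Right.status w)
        where
        cases : ¬ Right.Status w
        cases (Right.both w∈A w∈B) = w∉ (Right.both⇒∈side p w∈A w∈B)
        cases (Right.neither w∉A w∉B) = [ w∉A , w∉B ]′ (⊆∪ w∈Z)
        cases (Right.one d) = contradiction
          (trans (sym c′≡) (trans (c′-agrees (subst (λ x → ρ x ≡ x) (sym (Right.∉side⇒dart p d w∉)) (ρ-dart d))) (c-∈ p w∈Z)))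
          λ ()

    -- The vertices with no departure in use, where the new paths stop.
    ends : Subset n
    ends = SelL.unselected

    ends-transversal : Transversal A₀ B₀ π₀ ends
    ends-transversal = SelL.unselected-transversal

    private
      abstract
        step : ∀ v → ∃[ w ] (v ∉ ends → ∃[ p ] (SelL.Selected v p × w ≡ R.σ p v))
        step v = cases (v ∈? ends)
          where
          cases : Dec (v ∈ ends) → ∃[ w ] (v ∉ ends → ∃[ p ] (SelL.Selected v p × w ≡ R.σ p v))
          -- A default value: nothing is claimed about `next` on `ends`.
          cases (yes v∈) = v , contradiction v∈
          cases (no v∉)  = let (p , sel) = SelL.∉unselected⇒selected v∉ in R.σ p v , λ _ → p , sel , refl

    next : Fin n → Fin n
    next = proj₁ ∘ step

    private
      next-selected : ∀ {v} → v ∉ ends → ∃[ p ] (SelL.Selected v p × next v ≡ R.σ p v)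
      next-selected {v} = proj₂ (step v)

    next-∉ : ∀ {v} → v ∉ ends → next v ∉ Z
    next-∉ v∉ = let (p , sel , eq) = next-selected v∉ in
      subst (_∉ Z) (sym eq) (selected⇒∉Z p (σ-selected p sel))

    -- Both steps arrive through a selected dart of the same vertex. By uniqueness they belong to
    -- the same linking, whose `σ` is invertible.
    next-injective : ∀ {u v} → u ∉ ends → v ∉ ends → next u ≡ next v → u ≡ v
    next-injective {u} {v} u∉ v∉ eq =
      let (p , selu , equ) = next-selected u∉
          (q , selv , eqv) = next-selected v∉
      in same p q selu selv (trans (sym equ) (trans eq eqv))
      where
      same : ∀ p q → SelL.Selected u p → SelL.Selected v q → R.σ p u ≡ R.σ q v → u ≡ v
      same p q selu selv σ≡ with SelR.selected-unique p q (σ-selected p selu)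
        (subst (λ w → SelR.Selected w q) (sym σ≡) (σ-selected q selv))
      ... | refl = trans (sym (R.τ∘σ p u)) (trans (cong (R.τ p) σ≡) (R.τ∘σ p v))

    next-arc : ∀ {v} → v ∉ ends → v ≡ next v ⊎ G v (next v) ≡ true
    next-arc {v} v∉ =
      let (p , sel , eq) = next-selected v∉
      in subst (λ w → v ≡ w ⊎ G v w ≡ true) (sym eq)
           (subst (λ u → u ≡ R.σ p v ⊎ G u (R.σ p v) ≡ true) (R.τ∘σ p v) (R.arc p (proj₁ (σ-selected p sel))))

-- Reading disjoint paths off a successor map.

enumerate : (Z : Subset n) → ∃[ k ] Σ (Fin k → Fin n) λ f →
  (∀ i j → f i ≡ f j → i ≡ j) × (∀ i → f i ∈ Z) × (∀ {x} → x ∈ Z → ∃[ i ] (f i ≡ x))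
enumerate [] = 0 , (λ ()) , (λ ()) , (λ ()) , λ ()
enumerate (outside ∷ Z) with enumerate Z
... | k , f , inj , f∈ , onto = k , suc ∘ f , (λ i j → inj i j ∘ Finₚ.suc-injective) , there ∘ f∈ ,
  λ { (there x∈) → let (i , eq) = onto x∈ in i , cong suc eq }
enumerate (inside ∷ Z) with enumerate Z
... | k , f , inj , f∈ , onto = suc k , g , g-inj , g∈ , g-onto
  where
  g : Fin (suc k) → Fin _
  g zero    = zero
  g (suc i) = suc (f i)

  g-inj : ∀ i j → g i ≡ g j → i ≡ j
  g-inj zero    zero    _  = refl
  g-inj (suc i) (suc j) eq = cong suc (inj i j (Finₚ.suc-injective eq))

  g∈ : ∀ i → g i ∈ inside ∷ Z
  g∈ zero    = here
  g∈ (suc i) = there (f∈ i)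

  g-onto : ∀ {x} → x ∈ inside ∷ Z → ∃[ i ] (g i ≡ x)
  g-onto here       = zero , refl
  g-onto (there x∈) = let (i , eq) = onto x∈ in suc i , cong suc eq

module Follow {G : Digraph n} (Z Y : Subset n) (next : Fin n → Fin n)
              (next-∉ : ∀ {v} → v ∉ Y → next v ∉ Z)
              (next-injective : ∀ {u v} → u ∉ Y → v ∉ Y → next u ≡ next v → u ≡ v)
              (next-arc : ∀ {v} → v ∉ Y → v ≡ next v ⊎ G v (next v) ≡ true) where

  orbit : Fin n → ℕ → Fin n
  orbit x zero    = x
  orbit x (suc i) = next (orbit x i)

  Avoids : Fin n → ℕ → Set
  Avoids x i = ∀ {j} → j < i → orbit x j ∉ Y

  -- Steps cancel by `next-injective`; if one orbit is used up first, its start in `Z` would be a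
  -- value of `next`. This one fact makes paths simple, disjoint and finite.
  orbit-injective : ∀ {x y} → x ∈ Z → y ∈ Z → ∀ i j → Avoids x i → Avoids y j →
                    orbit x i ≡ orbit y j → x ≡ y × i ≡ j
  orbit-injective _   _   zero    zero    _  _  eq = eq , refl
  orbit-injective x∈Z _   zero    (suc j) _  ay eq = contradiction (subst (_∈ Z) eq x∈Z) (next-∉ (ay (n<1+n j)))
  orbit-injective _   y∈Z (suc i) zero    ax _  eq = contradiction (subst (_∈ Z) (sym eq) y∈Z) (next-∉ (ax (n<1+n i)))
  orbit-injective x∈Z y∈Z (suc i) (suc j) ax ay eq =
    let (x≡y , i≡j) = orbit-injective x∈Z y∈Z i j (ax ∘ m<n⇒m<1+n) (ay ∘ m<n⇒m<1+n)
                        (next-injective (ax (n<1+n i)) (ay (n<1+n j)) eq)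
    in x≡y , cong suc i≡j

  FirstHit : Fin n → Set
  FirstHit x = ∃[ ℓ ] (Avoids x ℓ × orbit x ℓ ∈ Y)

  search : ∀ x k → FirstHit x ⊎ Avoids x k
  search x zero = inj₂ λ ()
  search x (suc k) with search x k
  ... | inj₁ hit = inj₁ hit
  ... | inj₂ avoids with orbit x k ∈? Y
  ...   | yes hit = inj₁ (k , avoids , hit)
  ...   | no miss = inj₂ λ j<1+k → [ avoids , (λ { refl → miss }) ]′ (m≤n⇒m<n∨m≡n (s≤s⁻¹ j<1+k))

  -- An orbit avoiding `Y` for `suc n` steps would repeat a vertex by the pigeonhole principle.
  firstHit : ∀ {x} → x ∈ Z → FirstHit x
  firstHit {x} x∈Z with search x (suc n)
  ... | inj₁ hit = hit
  ... | inj₂ avoids with pigeonhole (n<1+n n) (orbit x ∘ toℕ)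
  ...   | i , j , i<j , eq = contradiction
    (proj₂ (orbit-injective x∈Z x∈Z (toℕ i) (toℕ j) (before i) (before j) eq)) (<⇒≢ i<j)
    where
    before : ∀ (i : Fin (suc n)) → Avoids x (toℕ i)
    before i j<i = avoids (<-trans j<i (toℕ<n i))

  module _ {x : Fin n} (x∈Z : x ∈ Z) where

    private
      ℓ : ℕ
      ℓ = proj₁ (firstHit x∈Z)

    avoids-upto : ∀ (a : Fin (suc ℓ)) → Avoids x (toℕ a)
    avoids-upto a j<a = proj₁ (proj₂ (firstHit x∈Z)) (<-≤-trans j<a (s≤s⁻¹ (toℕ<n a)))

    path : Path G
    path = record
      { len    = ℓ
      ; vert   = orbit x ∘ toℕ
      ; arcs   = λ i → subst (λ j → G (orbit x j) (orbit x (suc (toℕ i))) ≡ true) (sym (toℕ-inject₁ i)) (arc i)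
      ; simple = λ a b eq → toℕ-injective
          (proj₂ (orbit-injective x∈Z x∈Z (toℕ a) (toℕ b) (avoids-upto a) (avoids-upto b) eq))
      }
      where
      arc : ∀ (i : Fin ℓ) → G (orbit x (toℕ i)) (orbit x (suc (toℕ i))) ≡ true
      arc i with next-arc (avoids-upto (suc i) (n<1+n (toℕ i)))
      ... | inj₂ arc  = arc
      -- A routing may fix a vertex, but before the first hit this would repeat a vertex of the
      -- orbit.
      ... | inj₁ loop = contradiction
        (proj₂ (orbit-injective x∈Z x∈Z (toℕ i) (suc (toℕ i)) (avoids-upto (suc i) ∘ m<n⇒m<1+n) (avoids-upto (suc i)) loop))
        (<⇒≢ (n<1+n _))

    path-end : end path ∈ Y
    path-end = subst (λ j → orbit x j ∈ Y) (sym (toℕ-fromℕ ℓ)) (proj₂ (proj₂ (firstHit x∈Z)))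

  linked : ∀ {s} (N : Matroid s) (ι : Fin s → Fin n) {Y₀} → Ind N Y₀ →
           (∀ {v} → v ∈ Y → ∃[ t ] (t ∈ Y₀ × ι t ≡ v)) → Linked G N ι Z
  linked N ι {Y₀} indY₀ pull with enumerate Z
  ... | k , f , f-inj , f∈ , f-onto =
    k , path ∘ f∈ , T ,
    (λ x → mk⇔ f-onto (λ { (i , refl) → f∈ i })) ,
    (λ i j i≢j a b eq → i≢j (f-inj i j
      (proj₁ (orbit-injective (f∈ i) (f∈ j) (toℕ a) (toℕ b) (avoids-upto (f∈ i) a) (avoids-upto (f∈ j) b) eq)))) ,
    (λ i → proj₂ (proj₂ (pull (path-end (f∈ i))))) ,
    -- The ends actually reached come from `Y₀`, so no count of them is required.
    ind-⊆ N T⊆Y₀ indY₀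
    where
    T : Fin k → Fin _
    T i = proj₁ (pull (path-end (f∈ i)))

    T⊆Y₀ : range T ⊆ Y₀
    T⊆Y₀ t∈ with ∈-range⁻ T t∈
    ... | i , refl = proj₁ (proj₂ (pull (path-end (f∈ i))))

-- Induction by directed graphs.

module PushForward {s : ℕ} (ι : Fin s → Fin n) (ι-injective : ∀ i j → ι i ≡ ι j → i ≡ j)
                   {A B : Subset s} {π : Fin s → Fin s} (pairing : Pairing A B π) where

  open Pairing pairing
  open Extension ι (ι-injective _ _) (λ v → any? (λ t → ι t ≟F v))

  -- `Reroute` works on vertices whereas the pairing from `N` lives on `Fin s`; vertices outside the
  -- range of `ι` become fixed points.
  push : Fin n → Fin n
  push = extendBy π

  ∈-image-ι⁻ : ∀ {X t} → ι t ∈ image ι X → t ∈ X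
  ∈-image-ι⁻ {X} ιt∈ with ∈-image⁻ ι ιt∈
  ... | u , u∈X , eq = subst (_∈ X) (ι-injective _ _ eq) u∈X

  ∈-image-ι⁺ : ∀ {X t} → t ∈ X → ι t ∈ image ι X
  ∈-image-ι⁺ t∈X = ∈-image⁺ ι t∈X refl

  push-pairing : Pairing (image ι A) (image ι B) push
  push-pairing = record { involutive = extendBy-inverse {π} {π} involutive ; moved = moved′ }
    where
    moved′ : ∀ {v} → push v ≢ v → Differ (image ι A) (image ι B) v
    moved′ {v} mv = cases (any? (λ t → ι t ≟F v))
      where
      cases : Dec (∃[ t ] (ι t ≡ v)) → Differ (image ι A) (image ι B) v
      cases (no ∄t) = contradiction (extendBy-∉ π ∄t) mv
      cases (yes (t , refl)) with moved (λ eq → mv (trans (extendBy-h π t) (cong ι eq)))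
      ... | inj₁ (t∈A , t∉B) = inj₁ (∈-image-ι⁺ t∈A , t∉B ∘ ∈-image-ι⁻)
      ... | inj₂ (t∈B , t∉A) = inj₂ (∈-image-ι⁺ t∈B , t∉A ∘ ∈-image-ι⁻)

  module _ {Y : Subset n} (t : Transversal (image ι A) (image ι B) push Y) where

    open Transversal t

    preimage : Subset s
    preimage = select (λ t → ι t ∈? Y)

    private
      ∈⁺ : ∀ {t} → ι t ∈ Y → t ∈ preimage
      ∈⁺ = ∈-select⁺ (λ t → ι t ∈? Y)

      ∈⁻ : ∀ {t} → t ∈ preimage → ι t ∈ Y
      ∈⁻ = ∈-select⁻ (λ t → ι t ∈? Y)

      push-moved : ∀ {t} → π t ≢ t → push (ι t) ≢ ι t
      push-moved {t} mv eq = mv (ι-injective _ _ (trans (sym (extendBy-h π t)) eq))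

    preimage-transversal : Transversal A B π preimage
    preimage-transversal = record
      { ∩⊆      = λ t∈A t∈B → ∈⁺ (∩⊆ (∈-image-ι⁺ t∈A) (∈-image-ι⁺ t∈B))
      ; ⊆∪      = λ t∈ → [ inj₁ ∘ ∈-image-ι⁻ , inj₂ ∘ ∈-image-ι⁻ ]′ (⊆∪ (∈⁻ t∈))
      ; atMost  = λ {t} mv t∈ πt∈ → atMost (push-moved mv) (∈⁻ t∈) (subst (_∈ Y) (sym (extendBy-h π t)) (∈⁻ πt∈))
      ; atLeast = λ {t} mv t∉ → ∈⁺ (subst (_∈ Y) (extendBy-h π t) (atLeast (push-moved mv) (t∉ ∘ ∈⁺)))
      }

    preimage-onto : ∀ {v} → v ∈ Y → ∃[ t ] (t ∈ preimage × ι t ≡ v)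
    preimage-onto v∈ with ⊆∪ v∈
    ... | inj₁ v∈A with ∈-image⁻ ι v∈A
    ...   | t , _ , refl = t , ∈⁺ v∈ , refl
    preimage-onto v∈ | inj₂ v∈B with ∈-image⁻ ι v∈B
    ...   | t , _ , refl = t , ∈⁺ v∈ , refl

-- The targets `A₀` and `B₀` of the two linkings are merely independent in `N`, hence the use of the
-- property for independent sets.
induction : SBRO-ClosedUnderInduction
induction G N ι M (ι-inj , indM) sbro = IndPairing⇒SBRO M pairs
  where
  open Equivalence

  pairs : IndPairing M
  pairs A B indA indB
    with A₀ , indA₀ , routeA ← linked⇒routing G N ι (to (indM A) indA)
       | B₀ , indB₀ , routeB ← linked⇒routing G N ι (to (indM B) indB)
    with π₀ , pairing₀ , ind₀ ← SBRO⇒IndPairing N sbro A₀ B₀ indA₀ indB₀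
    = π , pairing , λ Z t → from (indM Z)
        (Follow.linked Z (ends t) (next t) (next-∉ t) (next-injective t) (next-arc t) N ι
          (ind₀ _ (preimage-transversal (ends-transversal t)))
          (preimage-onto (ends-transversal t)))
    where
    open PushForward ι ι-inj pairing₀
    open Reroute routeA routeB push-pairing

theorem4 : SBRO-Complete
theorem4 = minors , duals , directSums , truncations , induction
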